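{- Let $H$ be a Hamiltonian cycle on a set of nodes $V$ with $|V|\le 15$, and let $G_b=(V,U,E)$ be a connected bipartite graph. Then the graph $G=(V\cup U, H\cup E)$ contains a second $V$-Hamiltonian cycle.
   Context: Graphs are finite and undirected; $(V,U,E)$ denotes a bipartite graph with (disjoint) sides $V$ and $U$ and edge set $E$; a cycle $H$ is identified with its edge set. For a graph $G$ and a subset $V$ of its nodes, a Hamiltonian cycle on $V$ is a simple cycle of $G$ whose node set is exactly $V$, and a $V$-Hamiltonian cycle is a simple cycle of $G$ whose node set contains $V$. $G$ contains a second $V$-Hamiltonian cycle if it contains a Hamiltonian cycle on $V$ and a $V$-Hamiltonian cycle that differ in at least one edge. -}

module Defs where

open import Data.Nat using (ℕ; suc; _+_)
open import Data.Nat.Properties using (m≤n⇒m<n∨m≡n; 1+n≢n)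
open import Data.Nat.DivMod using (_mod_; _%_; m<n⇒m%n≡m; n%n≡0)
open import Data.Fin using (Fin; toℕ)
open import Data.Fin.Properties using (_≟_; any?; toℕ<n; toℕ-fromℕ<)
open import Data.Fin.Subset using (Subset; _∈_; _∩_; _∪_; ⊤; Empty)
open import Data.Product using (_×_; _,_; ∃-syntax)
open import Data.Sum using (_⊎_; inj₁; inj₂; swap; map; [_,_])
open import Function using (_⇔_; Injective)
open import Level using (0ℓ)
open import Relation.Binary using (Rel; Symmetric; Decidable)
open import Relation.Binary.Construct.Closure.ReflexiveTransitive using (Star)
open import Relation.Binary.PropositionalEquality
  using (_≡_; _≢_; refl; sym; trans; cong)
open import Relation.Nullary using (¬_)
open import Relation.Nullary.Decidable using (_⊎-dec_; _×-dec_)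

private
  variable
    n : ℕ

-- Decidability of adjacency expresses that the edge set of a finite graph
-- is a finite set.
record Graph (n : ℕ) : Set₁ where
  field
    Adj    : Rel (Fin n) 0ℓ
    symm   : Symmetric Adj
    irrefl : ∀ {x} → ¬ Adj x x
    adj?   : Decidable Adj

open Graph public

_∪ᴳ_ : Graph n → Graph n → Graph n
G ∪ᴳ G′ = record
  { Adj    = λ x y → Adj G x y ⊎ Adj G′ x y
  ; symm   = map (symm G) (symm G′)
  ; irrefl = [ irrefl G , irrefl G′ ]
  ; adj?   = λ x y → adj? G x y ⊎-dec adj? G′ x y
  }

-- Any two nodes are joined by a walk.
Connected : Graph n → Set
Connected G = ∀ x y → Star (Adj G) x y

-- A bipartite graph with sides V and U; its node set V ∪ U is all of Fin n.
record BipartiteGraph {n : ℕ} (V U : Subset n) : Set₁ where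
  field
    graph    : Graph n
    disjoint : Empty (V ∩ U)
    cover    : V ∪ U ≡ ⊤
    crossing : ∀ {x y} → Adj graph x y → (x ∈ V × y ∈ U) ⊎ (x ∈ U × y ∈ V)

open BipartiteGraph public

-- A simple cycle, traversed as node 0, node 1, …, node (2 + k), node 0.
-- Cycles of simple graphs have at least three nodes.
record Cycle (n : ℕ) : Set where
  field
    k         : ℕ
    node      : Fin (3 + k) → Fin n
    injective : Injective _≡_ _≡_ node

open Cycle public

next : ∀ {k} → Fin (3 + k) → Fin (3 + k)
next {k} i = suc (toℕ i) mod (3 + k)

private
  next≢ : ∀ {k} (i : Fin (3 + k)) → next i ≢ i
  next≢ {k} i eq with m≤n⇒m<n∨m≡n (toℕ<n i)
  ... | inj₁ lt =
    1+n≢n (trans (sym (m<n⇒m%n≡m lt))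
                 (trans (sym (toℕ-fromℕ< _)) (cong toℕ eq)))
  ... | inj₂ e with trans (sym (cong toℕ eq))
                          (trans (toℕ-fromℕ< _)
                                 (trans (cong (_% (3 + k)) e) (n%n≡0 (3 + k))))
  ...   | z with trans (sym (cong suc z)) e
  ...     | ()

-- The edge set of a cycle; cycles are compared only through this.
cycleGraph : Cycle n → Graph n
cycleGraph {n} c = record
  { Adj    = λ x y → Step x y ⊎ Step y x
  ; symm   = swap
  ; irrefl = [ noLoop , noLoop ]
  ; adj?   = λ x y → step? x y ⊎-dec step? y x
  }
  where
  Step : Rel (Fin n) 0ℓ
  Step x y = ∃[ i ] node c i ≡ x × node c (next i) ≡ y

  step? : Decidable Step
  step? x y = any? λ i → (node c i ≟ x) ×-dec (node c (next i) ≟ y)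

  noLoop : ∀ {x} → ¬ Step x x
  noLoop (i , p , q) = next≢ i (injective c (trans q (sym p)))

_IsOn_ : Fin n → Cycle n → Set
x IsOn c = ∃[ i ] node c i ≡ x

HasNodeSet : Cycle n → Subset n → Set
HasNodeSet c V = ∀ x → x IsOn c ⇔ x ∈ V

_IsCycleOf_ : Cycle n → Graph n → Set
c IsCycleOf G = ∀ {x y} → Adj (cycleGraph c) x y → Adj G x y

IsHamiltonianCycleOn : Graph n → Subset n → Cycle n → Set
IsHamiltonianCycleOn G V c = c IsCycleOf G × HasNodeSet c V

-- Nodes outside V are allowed on the cycle.
IsHamiltonianCycleThrough : Graph n → Subset n → Cycle n → Set
IsHamiltonianCycleThrough G V c = c IsCycleOf G × (∀ {x} → x ∈ V → x IsOn c)

DifferInAnEdge : Cycle n → Cycle n → Set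
DifferInAnEdge c d = ∃[ x ] ∃[ y ]
  ( Adj (cycleGraph c) x y × ¬ Adj (cycleGraph d) x y
  ⊎ Adj (cycleGraph d) x y × ¬ Adj (cycleGraph c) x y)

ContainsSecondHamiltonianCycle : Graph n → Subset n → Set
ContainsSecondHamiltonianCycle G V = ∃[ c ] ∃[ d ]
  IsHamiltonianCycleOn G V c × IsHamiltonianCycleThrough G V d × DifferInAnEdge c d

{-# OPTIONS --safe #-}
module Submission where

-- A parity argument in the style of Thomason's lollipops.
-- Adding up modulo 2 the edge sets of walks of G_b from all nodes of V to one
-- node x of V yields a subset F of the edges of G_b in which every node outside V
-- has even degree and every node of V other than x has odd degree.
-- Let y be the predecessor of x on H. Consider the paths from w to y that visit
-- V ∖ {x} and whose consecutive nodes of V are joined by an edge of H or, through a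
-- node u outside V used at most once, by two edges of F. Joining the end w to a
-- node z of the path and dropping the old connection just before z rotates the
-- path; joining w to x closes it, with the edge y x of H, to a V-Hamiltonian cycle.
-- From each path the number of its rotations, including the trivial one, plus the
-- number of its closings is odd: edges of H contribute an even number, and so does
-- each u ∉ V that is not an F-neighbour of w, whereas an F-neighbour u of w
-- contributes deg u - 1 if it is unused and exactly its own position if it is used.
-- Rotations are reversible, so modulo 2 they count only the trivial ones, one for
-- each path. Hence the number of closings is even. As H is one of them and no other
-- closing avoids all nodes outside V, some closing uses a node outside V.

open import Data.Nat using (ℕ; zero; suc; _+_; _≤_; _<_; z≤n; s≤s)
open import Data.Fin.Subset using (Subset; ∣_∣) renaming (_∈_ to _∈ˢ_; _∉_ to _∉ˢ_)
open import Defs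

open import Algebra.Bundles using (CommutativeRing)
open import Data.Bool using (Bool; true; false; _∧_; _xor_; not)
import Data.Bool.Properties as 𝔹
open import Data.Bool.Properties
  using (xor-same; xor-comm; xor-assoc; xor-identityʳ; xor-∧-commutativeRing;
         ∧-distribˡ-xor; ∧-zeroʳ; ∧-comm; ∧-identityʳ)
open import Algebra.Properties.CommutativeSemigroup
  (CommutativeRing.+-commutativeSemigroup xor-∧-commutativeRing)
  using (interchange)
open import Data.Fin using (Fin; zero; suc; toℕ; fromℕ; inject₁)
import Data.Fin.Properties as Fin
open import Data.Fin.Relation.Unary.Top using (view; ‵fromℕ; ‵inject₁)
open import Data.Fin.Subset.Properties using (_∈?_; x∈p∩q⁺)
open import Data.List
  using (List; []; _∷_; [_]; _++_; map; length; take; drop; lookup; tabulate;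
         allFin; upTo; applyUpTo; cartesianProductWith; cartesianProduct)
open import Data.List.Properties
  using (map-++; map-tabulate; ≡-dec; ∷-injective; length-++; length-tabulate)
open import Data.List.Membership.Propositional using (_∈_; _∉_)
open import Data.List.Membership.Propositional.Properties using (∈-upTo⁻; ∈-lookup; ∈-map⁻)
open import Data.List.Relation.Unary.All as All using (All; []; _∷_)
open import Data.List.Relation.Unary.Any using (here; there; index)
open import Data.List.Relation.Unary.Any.Properties using (lookup-index)
open import Data.Maybe using (Maybe; just; nothing)
import Data.Maybe.Properties as Maybe
open import Data.Nat.DivMod using (m<n⇒m%n≡m; n%n≡0; _%_)
import Data.Nat.Properties as ℕ
open import Data.Nat.Solver using (module +-*-Solver)
open import Data.Product using (_×_; _,_; Σ-syntax; ∃-syntax; proj₁; proj₂)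
import Data.Product.Properties as ×
open import Data.Sum using (_⊎_; inj₁; inj₂)
open import Data.Unit using (⊤; tt)
open import Function using (_∘_; _⇔_; mk⇔; id; Equivalence)
open import Level using (0ℓ)
open import Relation.Binary using (Rel; DecidableEquality)
open import Relation.Binary.Construct.Closure.ReflexiveTransitive using (Star; ε; _◅_)
open import Relation.Binary.PropositionalEquality hiding ([_])
open import Relation.Nullary using (¬_; Dec; yes; no; does; contradiction)
open import Relation.Nullary.Decidable using (dec-true; dec-false; does-⇔; _×-dec_; map′; ¬?)

private
  variable
    A B C : Set
    n q : ℕ

-- Sums modulo 2

does⇒ : (d : Dec A) → does d ≡ true → A
does⇒ (yes p) _ = p

⨁ : List A → (A → Bool) → Bool
⨁ []       f = false
⨁ (x ∷ xs) f = f x xor ⨁ xs f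

⨁-cong∈ : ∀ (xs : List A) {f g : A → Bool} → (∀ {x} → x ∈ xs → f x ≡ g x) → ⨁ xs f ≡ ⨁ xs g
⨁-cong∈ []       h = refl
⨁-cong∈ (x ∷ xs) h = cong₂ _xor_ (h (here refl)) (⨁-cong∈ xs (h ∘ there))

⨁-cong : ∀ (xs : List A) {f g : A → Bool} → (∀ x → f x ≡ g x) → ⨁ xs f ≡ ⨁ xs g
⨁-cong xs h = ⨁-cong∈ xs (λ _ → h _)

⨁-false : (xs : List A) → ⨁ xs (λ _ → false) ≡ false
⨁-false []       = refl
⨁-false (_ ∷ xs) = ⨁-false xs

⨁-xor : ∀ (xs : List A) (f g : A → Bool) → ⨁ xs (λ x → f x xor g x) ≡ ⨁ xs f xor ⨁ xs g
⨁-xor []       f g = refl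
⨁-xor (x ∷ xs) f g = trans (cong ((f x xor g x) xor_) (⨁-xor xs f g)) (interchange (f x) _ _ _)

⨁-∧ : ∀ (xs : List A) p (f : A → Bool) → ⨁ xs (λ x → p ∧ f x) ≡ p ∧ ⨁ xs f
⨁-∧ xs false f = ⨁-false xs
⨁-∧ xs true  f = refl

⨁-swap : ∀ (xs : List A) (ys : List B) (f : A → B → Bool) →
  ⨁ xs (λ x → ⨁ ys (f x)) ≡ ⨁ ys (λ y → ⨁ xs (λ x → f x y))
⨁-swap []       ys f = sym (⨁-false ys)
⨁-swap (x ∷ xs) ys f = trans (cong (⨁ ys (f x) xor_) (⨁-swap xs ys f))
                             (sym (⨁-xor ys (f x) _))

⨁-++ : ∀ (xs ys : List A) (f : A → Bool) → ⨁ (xs ++ ys) f ≡ ⨁ xs f xor ⨁ ys f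
⨁-++ []       ys f = refl
⨁-++ (x ∷ xs) ys f = trans (cong (f x xor_) (⨁-++ xs ys f)) (sym (xor-assoc (f x) _ _))

⨁-map : ∀ (g : A → B) xs (f : B → Bool) → ⨁ (map g xs) f ≡ ⨁ xs (f ∘ g)
⨁-map g []       f = refl
⨁-map g (x ∷ xs) f = cong (f (g x) xor_) (⨁-map g xs f)

⨁-true : ∀ (xs : List A) (f : A → Bool) → ⨁ xs f ≡ true → ∃[ x ] f x ≡ true
⨁-true (x ∷ xs) f eq with f x in fx
... | true  = x , fx
... | false = ⨁-true xs f eq

-- Terms at two different positions come in symmetric pairs and cancel modulo 2. A reversible
-- relation is thereby counted through its diagonal alone.
⨁-diagonal : ∀ (xs : List A) (f : A → A → Bool) → (∀ x y → f x y ≡ f y x) →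
  ⨁ xs (λ x → ⨁ xs (f x)) ≡ ⨁ xs (λ x → f x x)
⨁-diagonal []       f s = refl
⨁-diagonal (x ∷ xs) f s = begin
  (f x x xor r) xor ⨁ xs (λ y → f y x xor ⨁ xs (f y))
    ≡⟨ cong ((f x x xor r) xor_) (trans (⨁-xor xs (λ y → f y x) _)
         (cong (_xor ⨁ xs (λ y → ⨁ xs (f y))) (⨁-cong xs (λ y → s y x)))) ⟩
  (f x x xor r) xor (r xor ⨁ xs (λ y → ⨁ xs (f y)))
    ≡⟨ trans (xor-assoc (f x x) r _) (cong (f x x xor_)
         (trans (sym (xor-assoc r r _)) (cong (_xor _) (xor-same r)))) ⟩
  f x x xor ⨁ xs (λ y → ⨁ xs (f y))
    ≡⟨ cong (f x x xor_) (⨁-diagonal xs f s) ⟩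
  f x x xor ⨁ xs (λ y → f y y) ∎
  where
  open ≡-Reasoning
  r = ⨁ xs (f x)

⨁-upTo : ∀ (g : ℕ → Bool) n → ⨁ (upTo (suc n)) g ≡ g 0 xor ⨁ (upTo n) (g ∘ suc)
⨁-upTo g n = cong (g 0 xor_) (shift n id)
  where
  shift : ∀ n (h : ℕ → ℕ) → ⨁ (applyUpTo (suc ∘ h) n) g ≡ ⨁ (applyUpTo h n) (g ∘ suc)
  shift zero    h = refl
  shift (suc n) h = cong (g (suc (h 0)) xor_) (shift n (h ∘ suc))

-- Naming a position through a splitting of the list, rather than a lookup, matches the form in
-- which rotations are analysed.
⨁-positions : ∀ (xs : List A) (g : ℕ → Bool) (h : A → Bool) →
  (∀ as x bs → xs ≡ as ++ x ∷ bs → g (length as) ≡ h x) →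
  ⨁ (upTo (length xs)) g ≡ ⨁ xs h
⨁-positions []       g h eq = refl
⨁-positions (x ∷ xs) g h eq = trans (⨁-upTo g (length xs))
  (cong₂ _xor_ (eq [] x xs refl)
    (⨁-positions xs (g ∘ suc) h (λ as y bs p → eq (x ∷ as) y bs (cong (x ∷_) p))))

⨁-product : ∀ (h : A → B → C) xs ys (f : C → Bool) →
  ⨁ (cartesianProductWith h xs ys) f ≡ ⨁ xs (λ x → ⨁ ys (λ y → f (h x y)))
⨁-product h []       ys f = refl
⨁-product h (x ∷ xs) ys f = trans (⨁-++ (map (h x) ys) _ f)
  (cong₂ _xor_ (⨁-map (h x) ys f) (⨁-product h xs ys f))

-- Occurrence counts and lists of odd multiplicity.

module _ {A : Set} (_≟_ : DecidableEquality A) where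

  occ : A → List A → ℕ
  occ x []       = 0
  occ x (y ∷ ys) with x ≟ y
  ... | yes _ = suc (occ x ys)
  ... | no  _ = occ x ys

  -- Odd multiplicity is all that a sum modulo 2 can see; a list with odd multiplicities serves as
  -- well as an enumeration without repetitions.
  OddIn : List A → A → Set
  OddIn xs x = ⨁ xs (λ y → does (x ≟ y)) ≡ true

  occ-here : ∀ {x y} ys → x ≡ y → occ x (y ∷ ys) ≡ suc (occ x ys)
  occ-here {x} {y} ys eq with x ≟ y
  ... | yes _  = refl
  ... | no  ne = contradiction eq ne

  occ-there : ∀ {x y} ys → x ≢ y → occ x (y ∷ ys) ≡ occ x ys
  occ-there {x} {y} ys ne with x ≟ y
  ... | yes eq = contradiction eq ne
  ... | no  _  = refl

  occ-∷-≤ : ∀ x y ys → occ x ys ≤ occ x (y ∷ ys)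
  occ-∷-≤ x y ys with x ≟ y
  ... | yes _ = ℕ.n≤1+n _
  ... | no  _ = ℕ.≤-refl

  occ-++ : ∀ x ys zs → occ x (ys ++ zs) ≡ occ x ys + occ x zs
  occ-++ x []       zs = refl
  occ-++ x (y ∷ ys) zs with x ≟ y
  ... | yes _ = cong suc (occ-++ x ys zs)
  ... | no  _ = occ-++ x ys zs

  ∈⇒occ : ∀ {x ys} → x ∈ ys → 1 ≤ occ x ys
  ∈⇒occ {x} {y ∷ ys} (here eq) = subst (1 ≤_) (sym (occ-here ys eq)) (s≤s z≤n)
  ∈⇒occ {x} {y ∷ ys} (there i) = ℕ.≤-trans (∈⇒occ i) (occ-∷-≤ x y ys)

  occ-repeat : ∀ x ys → x ∈ ys → ¬ (occ x (x ∷ ys) ≤ 1)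
  occ-repeat x ys x∈ le = ℕ.<⇒≱ (s≤s (∈⇒occ x∈)) (subst (_≤ 1) (occ-here ys refl) le)

  occ⇒∈ : ∀ {x} ys → 1 ≤ occ x ys → x ∈ ys
  occ⇒∈ {x} (y ∷ ys) le with x ≟ y
  ... | yes eq = here eq
  ... | no  _  = there (occ⇒∈ ys le)

  ∉⇒occ≡0 : ∀ {x ys} → ¬ x ∈ ys → occ x ys ≡ 0
  ∉⇒occ≡0 {x} {ys} x∉ with occ x ys in eq
  ... | zero  = refl
  ... | suc _ = contradiction (occ⇒∈ ys (subst (1 ≤_) (sym eq) (s≤s z≤n))) x∉

  ⨁-occ≡0 : ∀ x ys → occ x ys ≡ 0 → ⨁ ys (λ y → does (x ≟ y)) ≡ false
  ⨁-occ≡0 x []       eq = refl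
  ⨁-occ≡0 x (y ∷ ys) eq with x ≟ y
  ... | no _ = ⨁-occ≡0 x ys eq

  occ≡1⇒odd : ∀ x ys → occ x ys ≡ 1 → OddIn ys x
  occ≡1⇒odd x (y ∷ ys) eq with x ≟ y
  ... | yes _ = cong not (⨁-occ≡0 x ys (ℕ.suc-injective eq))
  ... | no  _ = occ≡1⇒odd x ys eq

  ⨁-select : ∀ xs x (f : A → Bool) → OddIn xs x → ⨁ xs (λ y → does (x ≟ y) ∧ f y) ≡ f x
  ⨁-select xs x f odd = begin
    ⨁ xs (λ y → does (x ≟ y) ∧ f y) ≡⟨ ⨁-cong xs at ⟩
    ⨁ xs (λ y → f x ∧ does (x ≟ y)) ≡⟨ ⨁-∧ xs (f x) _ ⟩
    f x ∧ ⨁ xs (λ y → does (x ≟ y)) ≡⟨ cong (f x ∧_) odd ⟩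
    f x ∧ true                      ≡⟨ ∧-identityʳ _ ⟩
    f x ∎
    where
    open ≡-Reasoning
    at : ∀ y → does (x ≟ y) ∧ f y ≡ f x ∧ does (x ≟ y)
    at y with x ≟ y
    ... | yes refl = sym (∧-identityʳ _)
    ... | no  _    = sym (∧-zeroʳ _)

  -- Insert a Kronecker delta and exchange the two sums: both lists represent the whole type modulo
  -- 2.
  ⨁-odd : ∀ xs ys (f : A → Bool) → (∀ x → OddIn xs x) → (∀ x → OddIn ys x) → ⨁ xs f ≡ ⨁ ys f
  ⨁-odd xs ys f oddx oddy = begin
    ⨁ xs f
      ≡⟨ ⨁-cong xs (λ x → sym (⨁-select ys x f (oddy x))) ⟩
    ⨁ xs (λ x → ⨁ ys (λ y → does (x ≟ y) ∧ f y))
      ≡⟨ ⨁-swap xs ys _ ⟩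
    ⨁ ys (λ y → ⨁ xs (λ x → does (x ≟ y) ∧ f y))
      ≡⟨ ⨁-cong ys (λ y → trans (⨁-cong xs (λ x → flip∧ x y)) (⨁-select xs y (λ _ → f y) (oddx y))) ⟩
    ⨁ ys f ∎
    where
    open ≡-Reasoning
    flip∧ : ∀ x y → does (x ≟ y) ∧ f y ≡ does (y ≟ x) ∧ f y
    flip∧ x y = cong (_∧ f y) (does-⇔ (mk⇔ sym sym) (x ≟ y) (y ≟ x))

-- For an injective `h` the equality test on pairs is the product of the tests on the components, so
-- multiplicities multiply.
product-odd : ∀ (_≟₁_ : DecidableEquality A) (_≟₂_ : DecidableEquality B) (_≟₃_ : DecidableEquality C)
  (h : A → B → C) → (∀ {x x′ y y′} → h x y ≡ h x′ y′ → x ≡ x′ × y ≡ y′) → ∀ xs ys x y →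
  OddIn _≟₁_ xs x → OddIn _≟₂_ ys y → OddIn _≟₃_ (cartesianProductWith h xs ys) (h x y)
product-odd _≟₁_ _≟₂_ _≟₃_ h inj xs ys x y oddx oddy = begin
  ⨁ (cartesianProductWith h xs ys) (λ t → does (h x y ≟₃ t))
    ≡⟨ ⨁-product h xs ys _ ⟩
  ⨁ xs (λ x′ → ⨁ ys (λ y′ → does (h x y ≟₃ h x′ y′)))
    ≡⟨ ⨁-cong xs (λ x′ → ⨁-cong ys (λ y′ → does-⇔ (mk⇔ inj λ { (refl , refl) → refl })
         (h x y ≟₃ h x′ y′) ((x ≟₁ x′) ×-dec (y ≟₂ y′)))) ⟩
  ⨁ xs (λ x′ → ⨁ ys (λ y′ → does (x ≟₁ x′) ∧ does (y ≟₂ y′)))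
    ≡⟨ ⨁-cong xs (λ x′ → ⨁-∧ ys (does (x ≟₁ x′)) _) ⟩
  ⨁ xs (λ x′ → does (x ≟₁ x′) ∧ ⨁ ys (λ y′ → does (y ≟₂ y′)))
    ≡⟨ ⨁-select _≟₁_ xs x _ oddx ⟩
  ⨁ ys (λ y′ → does (y ≟₂ y′))
    ≡⟨ oddy ⟩
  true ∎
  where open ≡-Reasoning

words : ℕ → List A → List (List A)
words zero    xs = [] ∷ []
words (suc n) xs = cartesianProductWith _∷_ xs (words n xs)

words-odd : ∀ (_≟_ : DecidableEquality A) {xs} → (∀ x → OddIn _≟_ xs x) →
  ∀ w → OddIn (≡-dec _≟_) (words (length w) xs) w
words-odd _≟_ odd []      = refl
words-odd _≟_ {xs} odd (c ∷ w) =
  product-odd _≟_ (≡-dec _≟_) (≡-dec _≟_) _∷_ ∷-injective xs _ c w (odd c) (words-odd _≟_ odd w)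

occ-map-inj : ∀ {A : Set} {B : Set} (_≟₁_ : DecidableEquality A) (_≟₂_ : DecidableEquality B)
  (f : A → B) → (∀ {x y} → f x ≡ f y → x ≡ y) → ∀ x xs → occ _≟₂_ (f x) (map f xs) ≡ occ _≟₁_ x xs
occ-map-inj _≟₁_ _≟₂_ f inj x []       = refl
occ-map-inj _≟₁_ _≟₂_ f inj x (y ∷ ys) with x ≟₁ y
... | yes refl = trans (occ-here _≟₂_ (map f ys) refl) (cong suc (occ-map-inj _≟₁_ _≟₂_ f inj x ys))
... | no  ne   = trans (occ-there _≟₂_ (map f ys) (ne ∘ inj)) (occ-map-inj _≟₁_ _≟₂_ f inj x ys)

occ-allFin : ∀ {n} (i : Fin n) → occ Fin._≟_ i (allFin n) ≡ 1
occ-allFin {suc n} i = trans (cong (λ l → occ Fin._≟_ i (zero ∷ l)) (sym (map-tabulate id suc))) (go i)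
  where
  go : ∀ i → occ Fin._≟_ i (zero ∷ map suc (allFin n)) ≡ 1
  go zero    = cong suc (∉⇒occ≡0 Fin._≟_ (zero∉ (allFin n)))
    where
    zero∉ : ∀ {m} (xs : List (Fin m)) → ¬ (Fin.zero ∈ map Fin.suc xs)
    zero∉ (_ ∷ xs) (there p) = zero∉ xs p
  go (suc i) = trans (occ-map-inj Fin._≟_ Fin._≟_ suc Fin.suc-injective i (allFin n)) (occ-allFin i)

allFin-odd : ∀ {n} (i : Fin n) → OddIn Fin._≟_ (allFin n) i
allFin-odd {n} i = occ≡1⇒odd Fin._≟_ i (allFin n) (occ-allFin i)

-- Paths and their rotations

module Paths {m n : ℕ} (H : Fin m → Fin m → Bool) (H-sym : ∀ v w → H v w ≡ H w v)
  (F : Fin m → Fin n → Bool) where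

  Label : Set
  Label = Maybe (Fin n)

  Arc : Set
  Arc = Label × Fin m

  -- A path is its first node and the arcs from there on; the label of an arc says
  -- how its target is reached: along H (nothing) or through u (just u).
  Path : Set
  Path = Fin m × List Arc

  _≟ᴸ_ : DecidableEquality Label
  _≟ᴸ_ = Maybe.≡-dec Fin._≟_

  _≟ᴬ_ : DecidableEquality Arc
  _≟ᴬ_ = ×.≡-dec _≟ᴸ_ Fin._≟_

  _≟ᴾ_ : DecidableEquality Path
  _≟ᴾ_ = ×.≡-dec Fin._≟_ (≡-dec _≟ᴬ_)

  link : Label → Fin m → Fin m → Bool
  link nothing  v w = H v w
  link (just u) v w = F v u ∧ F w u

  link-sym : ∀ c v w → link c v w ≡ link c w v
  link-sym nothing  v w = H-sym v w
  link-sym (just u) v w = ∧-comm (F v u) (F w u)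

  Links : Fin m → List Arc → Set
  Links w []             = ⊤
  Links w ((c , v) ∷ ps) = link c w v ≡ true × Links v ps

  links? : ∀ w ps → Dec (Links w ps)
  links? w []             = yes tt
  links? w ((c , v) ∷ ps) = (link c w v 𝔹.≟ true) ×-dec links? v ps

  uses : Fin n → List Arc → ℕ
  uses u ps = occ _≟ᴸ_ (just u) (map proj₁ ps)

  vertices : Path → List (Fin m)
  vertices (w , ps) = w ∷ map proj₂ ps

  visits : Fin m → List (Fin m) → ℕ
  visits = occ Fin._≟_

  end : Fin m → List Arc → Fin m
  end w []             = w
  end w ((_ , v) ∷ ps) = end v ps

  uses-++ : ∀ u ps qs → uses u (ps ++ qs) ≡ uses u ps + uses u qs
  uses-++ u ps qs = trans (cong (occ _≟ᴸ_ (just u)) (map-++ proj₁ ps qs))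
                          (occ-++ _≟ᴸ_ (just u) (map proj₁ ps) (map proj₁ qs))

  visits-∷ : ∀ v w ws → visits v (w ∷ ws) ≡ visits v [ w ] + visits v ws
  visits-∷ v w ws = occ-++ Fin._≟_ v [ w ] ws

  end-++ : ∀ w as c z bs → end w (as ++ (c , z) ∷ bs) ≡ end z bs
  end-++ w []             c z bs = refl
  end-++ w ((_ , v) ∷ as) c z bs = end-++ v as c z bs

  Links-++⁻ : ∀ w as {c z bs} → Links w (as ++ (c , z) ∷ bs) → Links w as × Links z bs
  Links-++⁻ w []             (_ , ls) = tt , ls
  Links-++⁻ w ((_ , v) ∷ as) (l , ls) = (l , proj₁ ih) , proj₂ ih
    where ih = Links-++⁻ v as ls

  -- A label belongs to two consecutive nodes, so on reversal it passes to the arc into the other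
  -- one. The accumulator continues from `w` and keeps its direction.
  revOnto : Fin m → List Arc → List Arc → Path
  revOnto w []             qs = w , qs
  revOnto w ((c , v) ∷ ps) qs = revOnto v ps ((c , w) ∷ qs)

  reverseᴾ : Path → Path
  reverseᴾ (w , ps) = revOnto w ps []

  _++ᴾ_ : Path → List Arc → Path
  (w , ps) ++ᴾ qs = w , ps ++ qs

  revOnto-++ : ∀ w ps qs rs → revOnto w ps (qs ++ rs) ≡ revOnto w ps qs ++ᴾ rs
  revOnto-++ w []             qs rs = refl
  revOnto-++ w ((c , v) ∷ ps) qs rs = revOnto-++ v ps ((c , w) ∷ qs) rs

  -- For empty `qs` this says that reversal is an involution, which makes rotations reversible. The
  -- accumulator is kept general for the induction.
  reverse-revOnto : ∀ w ps qs → reverseᴾ (revOnto w ps qs) ≡ revOnto w qs ps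
  reverse-revOnto w []             qs = refl
  reverse-revOnto w ((c , v) ∷ ps) qs = reverse-revOnto v ps ((c , w) ∷ qs)

  length-revOnto : ∀ w ps qs → length (proj₂ (revOnto w ps qs)) ≡ length ps + length qs
  length-revOnto w []             qs = refl
  length-revOnto w ((c , v) ∷ ps) qs =
    trans (length-revOnto v ps ((c , w) ∷ qs)) (ℕ.+-suc (length ps) (length qs))

  visits-revOnto : ∀ v w ps qs →
    visits v (vertices (revOnto w ps qs)) ≡ visits v (w ∷ map proj₂ ps) + visits v (map proj₂ qs)
  visits-revOnto v w []             qs = visits-∷ v w (map proj₂ qs)
  visits-revOnto v w ((c , z) ∷ ps) qs = begin
    visits v (vertices (revOnto z ps ((c , w) ∷ qs)))
      ≡⟨ visits-revOnto v z ps ((c , w) ∷ qs) ⟩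
    Z + visits v (w ∷ map proj₂ qs)
      ≡⟨ cong (Z +_) (visits-∷ v w (map proj₂ qs)) ⟩
    Z + (W + Q)
      ≡⟨ solve 3 (λ z w q → z :+ (w :+ q) := (w :+ z) :+ q) refl Z W Q ⟩
    (W + Z) + Q
      ≡⟨ cong (_+ Q) (sym (visits-∷ v w (z ∷ map proj₂ ps))) ⟩
    visits v (w ∷ z ∷ map proj₂ ps) + Q ∎
    where
    open ≡-Reasoning
    open +-*-Solver
    Z = visits v (z ∷ map proj₂ ps)
    W = visits v [ w ]
    Q = visits v (map proj₂ qs)

  uses-revOnto : ∀ u w ps qs → uses u (proj₂ (revOnto w ps qs)) ≡ uses u ps + uses u qs
  uses-revOnto u w []             qs = refl
  uses-revOnto u w ((c , z) ∷ ps) qs = begin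
    uses u (proj₂ (revOnto z ps ((c , w) ∷ qs))) ≡⟨ uses-revOnto u z ps ((c , w) ∷ qs) ⟩
    uses u ps + uses u ((c , w) ∷ qs)            ≡⟨ cong (uses u ps +_) (uses-++ u [ c , w ] qs) ⟩
    P + (K + Q)                                  ≡⟨ solve 3 (λ p c q → p :+ (c :+ q) := (c :+ p) :+ q) refl P K Q ⟩
    (K + P) + Q                                  ≡⟨ cong (_+ Q) (sym (uses-++ u [ c , z ] ps)) ⟩
    uses u ((c , z) ∷ ps) + uses u qs ∎
    where
    open ≡-Reasoning
    open +-*-Solver
    P = uses u ps
    K = uses u [ c , z ]
    Q = uses u qs

  end-revOnto : ∀ w ps qs → end (proj₁ (revOnto w ps qs)) (proj₂ (revOnto w ps qs)) ≡ end w qs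
  end-revOnto w []             qs = refl
  end-revOnto w ((c , v) ∷ ps) qs = end-revOnto v ps ((c , w) ∷ qs)

  Links-revOnto⁺ : ∀ w ps {qs} → Links w ps → Links w qs →
    Links (proj₁ (revOnto w ps qs)) (proj₂ (revOnto w ps qs))
  Links-revOnto⁺ w []             _        ls = ls
  Links-revOnto⁺ w ((c , v) ∷ ps) (l , ks) ls =
    Links-revOnto⁺ v ps ks (trans (link-sym c v w) l , ls)

  Links-revOnto⁻ : ∀ w ps {qs} → Links (proj₁ (revOnto w ps qs)) (proj₂ (revOnto w ps qs)) →
    Links w qs
  Links-revOnto⁻ w []             ls = ls
  Links-revOnto⁻ w ((c , v) ∷ ps) ls = proj₂ (Links-revOnto⁻ v ps ls)

  relabel : Label → List Arc → List Arc
  relabel c []             = []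
  relabel c ((_ , z) ∷ ps) = (c , z) ∷ ps

  firstLabel : List Arc → Label
  firstLabel []            = nothing
  firstLabel ((c , _) ∷ _) = c

  -- The connection into the target `z` of arc `j` is dropped, the part before it is reversed so
  -- that `w` comes to stand before `z`, and `c` labels the new connection. Rotating at `0` with the
  -- old label changes nothing.
  rotate : ℕ → Label → Path → Path
  rotate j c (w , ps) = revOnto w (take j ps) (relabel c (drop j ps))

  label : ℕ → Path → Label
  label j (w , ps) = firstLabel (drop j ps)

  drop-length : ∀ (as bs : List Arc) → drop (length as) (as ++ bs) ≡ bs
  drop-length []       bs = refl
  drop-length (_ ∷ as) bs = drop-length as bs

  take-length : ∀ (as bs : List Arc) → take (length as) (as ++ bs) ≡ as
  take-length []       bs = refl
  take-length (x ∷ as) bs = cong (x ∷_) (take-length as bs)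

  rotate-at : ∀ w as c z bs c′ → rotate (length as) c′ (w , as ++ (c , z) ∷ bs) ≡ revOnto w as ((c′ , z) ∷ bs)
  rotate-at w as c z bs c′ = cong₂ (revOnto w) (take-length as _) (cong (relabel c′) (drop-length as _))

  label-at : ∀ w as c z bs → label (length as) (w , as ++ (c , z) ∷ bs) ≡ c
  label-at w as c z bs = cong firstLabel (drop-length as _)

  record SplitAt (j : ℕ) (ps : List Arc) : Set where
    constructor splitAt
    field
      before : List Arc
      arc    : Arc
      after  : List Arc
      split≡ : ps ≡ before ++ arc ∷ after
      index≡ : j ≡ length before

  split : ∀ j ps → j < length ps → SplitAt j ps
  split zero    (p ∷ ps) _         = splitAt [] p ps refl refl
  split (suc j) (p ∷ ps) (s≤s lt) with split j ps lt
  ... | splitAt as q bs refl refl = splitAt (p ∷ as) q bs refl refl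

  -- Reversal keeps the number of arcs in front, so the new connection again stands at position `j`.
  label-rotate : ∀ j c P → j < length (proj₂ P) → label j (rotate j c P) ≡ c
  label-rotate j c (w , ps) lt with split j ps lt
  ... | splitAt as (d , z) bs refl refl = begin
    label j′ (rotate j′ c (w , as ++ (d , z) ∷ bs)) ≡⟨ cong (label j′) (rotate-at w as d z bs c) ⟩
    label j′ (revOnto w as ((c , z) ∷ bs))          ≡⟨ cong (label j′) (revOnto-++ w as [] _) ⟩
    label j′ (proj₁ Q , proj₂ Q ++ (c , z) ∷ bs)
      ≡⟨ cong (λ i → label i (proj₁ Q , proj₂ Q ++ (c , z) ∷ bs))
           (sym (trans (length-revOnto w as []) (ℕ.+-identityʳ _))) ⟩
    label (length (proj₂ Q)) (proj₁ Q , proj₂ Q ++ (c , z) ∷ bs) ≡⟨ label-at (proj₁ Q) (proj₂ Q) c z bs ⟩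
    c ∎
    where
    open ≡-Reasoning
    Q  = reverseᴾ (w , as)
    j′ = length as

  -- The same position with the label that was there before undoes a rotation: the part in front has
  -- kept its length and is reversed a second time.
  rotate-rotate : ∀ j c P → j < length (proj₂ P) → rotate j (label j P) (rotate j c P) ≡ P
  rotate-rotate j c (w , ps) lt with split j ps lt
  ... | splitAt as (d , z) bs refl refl = begin
    rotate j′ (label j′ P) (rotate j′ c P)
      ≡⟨ cong₂ (rotate j′) (label-at w as d z bs) (trans (rotate-at w as d z bs c) (revOnto-++ w as [] _)) ⟩
    rotate j′ d (proj₁ Q , proj₂ Q ++ (c , z) ∷ bs)
      ≡⟨ cong (λ i → rotate i d (proj₁ Q , proj₂ Q ++ (c , z) ∷ bs))
           (sym (trans (length-revOnto w as []) (ℕ.+-identityʳ _))) ⟩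
    rotate (length (proj₂ Q)) d (proj₁ Q , proj₂ Q ++ (c , z) ∷ bs)
      ≡⟨ rotate-at (proj₁ Q) (proj₂ Q) c z bs d ⟩
    revOnto (proj₁ Q) (proj₂ Q) ((d , z) ∷ bs)
      ≡⟨ revOnto-++ (proj₁ Q) (proj₂ Q) [] _ ⟩
    reverseᴾ Q ++ᴾ ((d , z) ∷ bs)
      ≡⟨ cong (_++ᴾ ((d , z) ∷ bs)) (reverse-revOnto w as []) ⟩
    P ∎
    where
    open ≡-Reasoning
    P  = w , as ++ (d , z) ∷ bs
    Q  = reverseᴾ (w , as)
    j′ = length as

  length-rotate : ∀ j c P → length (proj₂ (rotate j c P)) ≡ length (proj₂ P)
  length-rotate j c (w , ps) = trans (length-revOnto w (take j ps) _) (go j ps)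
    where
    go : ∀ j ps → length (take j ps) + length (relabel c (drop j ps)) ≡ length ps
    go zero    []       = refl
    go zero    (_ ∷ ps) = refl
    go (suc j) []       = refl
    go (suc j) (_ ∷ ps) = cong suc (go j ps)

  first-revOnto : ∀ w p ps qs → proj₁ (revOnto w (p ∷ ps) qs) ∈ map proj₂ (p ∷ ps)
  first-revOnto w (c , v) []       qs = here refl
  first-revOnto w (c , v) (p ∷ ps) qs = there (first-revOnto v p ps _)

  -- Finite enumerations of labels and paths.

  labels : List Label
  labels = nothing ∷ map just (allFin n)

  labels-odd : ∀ c → OddIn _≟ᴸ_ labels c
  labels-odd c = occ≡1⇒odd _≟ᴸ_ c labels (go c)
    where
    nothing∉ : ∀ (us : List (Fin n)) → ¬ (nothing ∈ map just us)
    nothing∉ (_ ∷ us) (there p) = nothing∉ us p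
    go : ∀ c → occ _≟ᴸ_ c labels ≡ 1
    go nothing  = cong suc (∉⇒occ≡0 _≟ᴸ_ (nothing∉ (allFin n)))
    go (just u) = trans (occ-map-inj Fin._≟_ _≟ᴸ_ just Maybe.just-injective u (allFin n)) (occ-allFin u)

  -- All arc lists of the given length are included, whether or not their arcs are linked; sums over
  -- them are filtered by validity.
  paths : ℕ → List Path
  paths ℓ = cartesianProduct (allFin m) (words ℓ (cartesianProduct labels (allFin m)))

  paths-odd : ∀ P → OddIn _≟ᴾ_ (paths (length (proj₂ P))) P
  paths-odd (w , ps) = product-odd Fin._≟_ (≡-dec _≟ᴬ_) _≟ᴾ_ _,_ ×.,-injective (allFin m) _ w ps
    (allFin-odd w)
    (words-odd _≟ᴬ_ (λ (c , v) → product-odd _≟ᴸ_ Fin._≟_ _≟ᴬ_ _,_ ×.,-injective labels (allFin m) c v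
                                   (labels-odd c) (allFin-odd v)) ps)

-- Every path has an odd number of rotations and closings

module Parity {m n : ℕ} (H : Fin m → Fin m → Bool) (H-sym : ∀ v w → H v w ≡ H w v)
  (F : Fin m → Fin n → Bool)
  (H-irrefl : ∀ v → H v v ≡ false)
  (H-even : ∀ v → ⨁ (allFin m) (H v) ≡ false)
  (F-even : ∀ u → ⨁ (allFin m) (λ v → F v u) ≡ false)
  (x y : Fin m)
  (F-odd : ∀ {v} → v ≢ x → ⨁ (allFin n) (F v) ≡ true)
  (ℓ′ : ℕ) where

  open Paths H H-sym F public

  ℓ : ℕ
  ℓ = suc ℓ′

  -- The arcs do not mention x, which precedes every path.
  record Valid (P : Path) : Set where
    constructor mkValid
    field
      length≡ : length (proj₂ P) ≡ ℓ
      once    : ∀ v → visits v (x ∷ vertices P) ≡ 1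
      end≡    : end (proj₁ P) (proj₂ P) ≡ y
      links   : Links (proj₁ P) (proj₂ P)
      simple  : ∀ u → uses u (proj₂ P) ≤ 1

  abstract
    valid? : ∀ P → Dec (Valid P)
    valid? P = map′ (λ (a , b , c , d , e) → mkValid a b c d e)
                    (λ V → let open Valid V in length≡ , once , end≡ , links , simple)
      ((length (proj₂ P) ℕ.≟ ℓ) ×-dec Fin.all? (λ v → visits v (x ∷ vertices P) ℕ.≟ 1)
        ×-dec (end (proj₁ P) (proj₂ P) Fin.≟ y) ×-dec links? (proj₁ P) (proj₂ P)
        ×-dec Fin.all? (λ u → uses u (proj₂ P) ℕ.≤? 1))

  -- After replacing one label c by c′, every u is still used at most once; c = nothing
  -- also covers adding c′. The old count is moved to the right to avoid subtraction.
  Free : List Arc → Label → Label → Set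
  Free ps c c′ = ∀ u → uses u ps + occ _≟ᴸ_ (just u) [ c′ ] ≤ 1 + occ _≟ᴸ_ (just u) [ c ]

  abstract
    free? : ∀ ps c c′ → Dec (Free ps c c′)
    free? ps c c′ = Fin.all? λ u → uses u ps + occ _≟ᴸ_ (just u) [ c′ ] ℕ.≤? 1 + occ _≟ᴸ_ (just u) [ c ]

  -- The arc (c , z) is either an arc of the path, whose label is replaced in a rotation,
  -- or (nothing , x), which stands for closing the path at x.
  Admissible : Path → Arc → Label → Set
  Admissible (w , ps) (c , z) c′ = link c′ w z ≡ true × Free ps c c′

  admissible? : ∀ P a c′ → Dec (Admissible P a c′)
  admissible? (w , ps) (c , z) c′ = (link c′ w z 𝔹.≟ true) ×-dec free? ps c c′

  does-admissible : ∀ w ps c z c′ →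
    does (admissible? (w , ps) (c , z) c′) ≡ link c′ w z ∧ does (free? ps c c′)
  does-admissible w ps c z c′ with link c′ w z
  ... | true  = refl
  ... | false = refl

  -- A rotation permutes the nodes and keeps the end, so only the new connection and the number of
  -- uses of a label can go wrong.
  rotate-valid : ∀ w as c z bs c′ → Valid (w , as ++ (c , z) ∷ bs) →
    Valid (rotate (length as) c′ (w , as ++ (c , z) ∷ bs)) ⇔ Admissible (w , as ++ (c , z) ∷ bs) (c , z) c′
  rotate-valid w as c z bs c′ V = mk⇔ to from
    where
    open Valid V
    open ℕ.≤-Reasoning
    open +-*-Solver
    ps = as ++ (c , z) ∷ bs
    Q  = revOnto w as ((c′ , z) ∷ bs)
    Q≡ : rotate (length as) c′ (w , ps) ≡ Q
    Q≡ = rotate-at w as c z bs c′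
    o : Fin n → Label → ℕ
    o u d = occ _≟ᴸ_ (just u) [ d ]
    usesQ : ∀ u → uses u (proj₂ Q) + o u c ≡ uses u ps + o u c′
    usesQ u = ≡.begin
      uses u (proj₂ Q) + o u c
        ≡.≡⟨ cong (_+ o u c) (trans (uses-revOnto u w as _) (cong (uses u as +_) (uses-++ u [ c′ , z ] bs))) ⟩
      (uses u as + (o u c′ + uses u bs)) + o u c
        ≡.≡⟨ solve 4 (λ a c′ b c → (a :+ (c′ :+ b)) :+ c := (a :+ (c :+ b)) :+ c′) refl
             (uses u as) (o u c′) (uses u bs) (o u c) ⟩
      (uses u as + (o u c + uses u bs)) + o u c′
        ≡.≡⟨ cong (_+ o u c′) (sym (trans (uses-++ u as _) (cong (uses u as +_) (uses-++ u [ c , z ] bs)))) ⟩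
      uses u ps + o u c′ ≡.∎
      where module ≡ = ≡-Reasoning
    to : Valid (rotate (length as) c′ (w , ps)) → Admissible (w , ps) (c , z) c′
    to VQ = proj₁ (Links-revOnto⁻ w as (Valid.links VQ′)) , λ u →
        subst (_≤ 1 + o u c) (usesQ u) (ℕ.+-monoˡ-≤ (o u c) (Valid.simple VQ′ u))
      where
      VQ′ : Valid Q
      VQ′ = subst Valid Q≡ VQ
    from : Admissible (w , ps) (c , z) c′ → Valid (rotate (length as) c′ (w , ps))
    from (l , free) = subst Valid (sym Q≡) record
      { length≡ = trans (trans (length-revOnto w as _) (sym (length-++ as))) length≡
      ; once    = λ v → trans (trans (visits-∷ v x (vertices Q)) (trans (cong (visits v [ x ] +_) (visitsQ v))
                                (sym (visits-∷ v x (vertices (w , ps)))))) (once v)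
      ; end≡    = trans (end-revOnto w as _) (trans (sym (end-++ w as c z bs)) end≡)
      ; links   = Links-revOnto⁺ w as (proj₁ (Links-++⁻ w as links)) (l , proj₂ (Links-++⁻ w as links))
      ; simple  = λ u → ℕ.+-cancelʳ-≤ (o u c) (uses u (proj₂ Q)) 1 (subst (_≤ 1 + o u c) (sym (usesQ u)) (free u))
      }
      where
      visitsQ : ∀ v → visits v (vertices Q) ≡ visits v (vertices (w , ps))
      visitsQ v = trans (visits-revOnto v w as _) (sym (trans
        (cong (visits v) (cong (w ∷_) (map-++ proj₂ as _)))
        (occ-++ Fin._≟_ v (w ∷ map proj₂ as) _)))

  -- Needed for a `u` in use: relabelling its own arc by `u` again requires the target of that arc
  -- to be an `F`-neighbour of `u`.
  Links⇒F : ∀ u w ps → Links w ps → ∀ {c z} → (c , z) ∈ ps → c ≡ just u → F z u ≡ true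
  Links⇒F u w ((_ , z) ∷ ps) (l , ls) (here refl) refl = go (F w u) (F z u) l
    where
    go : ∀ p q → p ∧ q ≡ true → q ≡ true
    go true q eq = eq
  Links⇒F u w ((_ , v) ∷ ps) (l , ls) (there i) eq = Links⇒F u v ps ls i eq

  module _ {w : Fin m} {ps : List Arc} (V : Valid (w , ps)) where
    open Valid V

    -- Together with `x`, a valid path lists every node exactly once.
    vertices-odd : ∀ (f : Fin m → Bool) →
      f x xor (f w xor ⨁ ps (f ∘ proj₂)) ≡ ⨁ (allFin m) f
    vertices-odd f = trans (cong (λ r → f x xor (f w xor r)) (sym (⨁-map proj₂ ps f)))
      (⨁-odd Fin._≟_ (x ∷ vertices (w , ps)) (allFin m) f
        (λ v → occ≡1⇒odd Fin._≟_ v (x ∷ vertices (w , ps)) (once v)) allFin-odd)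

    -- The nodes to which `w` may be joined are `x` and those behind `w`, that is, all but `w`
    -- itself.
    others : ∀ (f : Fin m → Bool) → ⨁ (allFin m) f ≡ false → f x xor ⨁ ps (f ∘ proj₂) ≡ f w
    others f even = go (f x) (f w) _ (trans (vertices-odd f) even)
      where
      go : ∀ p q r → p xor (q xor r) ≡ false → p xor r ≡ q
      go false false r    eq = eq
      go false true  true eq = refl
      go true  false true eq = refl
      go true  true  false eq = refl

    start≢ : w ≢ x
    start≢ refl = occ-repeat Fin._≟_ w (vertices (w , ps)) (here refl) (ℕ.≤-reflexive (once w))

    private
      -- Closing is treated as one more arc, so that the targets are all nodes other than `w`.
      arcs = (nothing , x) ∷ ps

      term : Label → Arc → Bool
      term c′ (c , z) = does (admissible? (w , ps) (c , z) c′)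

    free-nothing : ∀ c → Free ps c nothing
    free-nothing c u = ℕ.≤-trans (ℕ.≤-reflexive (ℕ.+-identityʳ _)) (ℕ.≤-trans (simple u) (ℕ.m≤m+n 1 _))

    free-just : ∀ u c → uses u ps ≤ occ _≟ᴸ_ (just u) [ c ] → Free ps c (just u)
    free-just u c le u′ = by (u′ Fin.≟ u)
      where
      open ℕ.≤-Reasoning
      by : Dec (u′ ≡ u) → uses u′ ps + occ _≟ᴸ_ (just u′) [ just u ] ≤ 1 + occ _≟ᴸ_ (just u′) [ c ]
      by (yes refl) = begin
        uses u ps + occ _≟ᴸ_ (just u) [ just u ] ≡⟨ cong (uses u ps +_) (occ-here _≟ᴸ_ {x = just u} [] refl) ⟩
        uses u ps + 1                            ≡⟨ ℕ.+-comm (uses u ps) 1 ⟩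
        1 + uses u ps                            ≤⟨ s≤s le ⟩
        1 + occ _≟ᴸ_ (just u) [ c ]              ∎
      by (no ne) = begin
        uses u′ ps + occ _≟ᴸ_ (just u′) [ just u ] ≡⟨ cong (uses u′ ps +_) (occ-there _≟ᴸ_ [] (ne ∘ Maybe.just-injective)) ⟩
        uses u′ ps + 0                             ≡⟨ ℕ.+-identityʳ _ ⟩
        uses u′ ps                                 ≤⟨ simple u′ ⟩
        1                                          ≤⟨ ℕ.m≤m+n 1 _ ⟩
        1 + occ _≟ᴸ_ (just u′) [ c ]               ∎

    free-just⁻ : ∀ u c → Free ps c (just u) → uses u ps ≤ occ _≟ᴸ_ (just u) [ c ]
    free-just⁻ u c free = ℕ.+-cancelˡ-≤ 1 _ _ (begin
      1 + uses u ps                            ≡⟨ ℕ.+-comm 1 (uses u ps) ⟩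
      uses u ps + 1                            ≡⟨ cong (uses u ps +_) (occ-here _≟ᴸ_ {x = just u} [] refl) ⟨
      uses u ps + occ _≟ᴸ_ (just u) [ just u ] ≤⟨ free u ⟩
      1 + occ _≟ᴸ_ (just u) [ c ]              ∎)
      where open ℕ.≤-Reasoning

    -- The label `nothing` never overuses a node, so this counts the neighbours of `w` on H, which
    -- are even in number and distinct from `w`.
    row-nothing : ⨁ arcs (term nothing) ≡ false
    row-nothing = begin
      ⨁ arcs (term nothing)
        ≡⟨ ⨁-cong arcs (λ (c , z) → trans (does-admissible w ps c z nothing)
             (trans (cong (H w z ∧_) (dec-true (free? ps c nothing) (free-nothing c))) (∧-identityʳ _))) ⟩
      H w x xor ⨁ ps (H w ∘ proj₂)
        ≡⟨ others (H w) (H-even w) ⟩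
      H w w
        ≡⟨ H-irrefl w ⟩
      false ∎
      where open ≡-Reasoning

    row-just : ∀ u → ⨁ arcs (term (just u)) ≡ F w u
    row-just u = byF (F w u) refl
      where
      open ≡-Reasoning
      unused : F w u ≡ true → uses u ps ≡ 0 → ⨁ arcs (term (just u)) ≡ true
      unused Fwu us = begin
        ⨁ arcs (term (just u))
          ≡⟨ ⨁-cong arcs (λ (c , z) → trans (does-admissible w ps c z (just u))
              (trans (cong₂ (λ f g → (f ∧ F z u) ∧ g) Fwu
                 (dec-true (free? ps c (just u)) (free-just u c (ℕ.≤-trans (ℕ.≤-reflexive us) z≤n))))
                (∧-identityʳ _))) ⟩
        F x u xor ⨁ ps (λ (_ , z) → F z u)
          ≡⟨ trans (others (λ z → F z u) (F-even u)) Fwu ⟩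
        true ∎

      -- On any other arc `u` would be used twice, while its own arc always accepts it again.
      own : F w u ≡ true → uses u ps ≡ 1 → ∀ {a} → a ∈ arcs → term (just u) a ≡ does (just u ≟ᴸ proj₁ a)
      own Fwu us {c , z} a∈ = by (just u ≟ᴸ c)
        where
        at : ∀ {z} → (just u , z) ∈ arcs → F z u ≡ true
        at (there i) = Links⇒F u w ps links i refl
        by : Dec (just u ≡ c) → term (just u) (c , z) ≡ does (just u ≟ᴸ c)
        by (yes refl) = trans
          (dec-true (admissible? (w , ps) (c , z) (just u)) (cong₂ _∧_ Fwu (at a∈) ,
            free-just u c (ℕ.≤-reflexive (trans us (sym (occ-here _≟ᴸ_ {x = just u} [] refl))))))
          (sym (dec-true (just u ≟ᴸ c) refl))
        by (no ne) = trans
          (dec-false (admissible? (w , ps) (c , z) (just u)) λ (_ , free) → ℕ.<⇒≱ (s≤s z≤n)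
            (ℕ.≤-trans (ℕ.≤-reflexive (sym us))
              (ℕ.≤-trans (free-just⁻ u c free) (ℕ.≤-reflexive (occ-there _≟ᴸ_ {x = just u} [] ne)))))
          (sym (dec-false (just u ≟ᴸ c) ne))

      used : F w u ≡ true → uses u ps ≡ 1 → ⨁ arcs (term (just u)) ≡ true
      used Fwu us = begin
        ⨁ arcs (term (just u))                            ≡⟨ ⨁-cong∈ arcs (own Fwu us) ⟩
        ⨁ arcs (λ (c , z) → does (just u ≟ᴸ c))           ≡⟨ sym (⨁-map proj₁ arcs (λ c → does (just u ≟ᴸ c))) ⟩
        ⨁ (map proj₁ ps) (λ c → does (just u ≟ᴸ c))       ≡⟨ occ≡1⇒odd _≟ᴸ_ (just u) (map proj₁ ps) us ⟩
        true                                              ∎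

      byUses : F w u ≡ true → ∀ k → uses u ps ≡ k → k ≤ 1 → ⨁ arcs (term (just u)) ≡ true
      byUses Fwu zero          us _ = unused Fwu us
      byUses Fwu (suc zero)    us _ = used Fwu us
      byUses Fwu (suc (suc _)) us (s≤s ())

      byF : ∀ b → F w u ≡ b → ⨁ arcs (term (just u)) ≡ F w u
      byF true  Fwu = trans (byUses Fwu (uses u ps) refl (simple u)) (sym Fwu)
      byF false Fwu = trans (⨁-cong arcs λ (c , z) → trans (does-admissible w ps c z (just u))
                        (cong (λ f → (f ∧ F z u) ∧ does (free? ps c (just u))) Fwu))
                        (trans (⨁-false arcs) (sym Fwu))

    -- Count by labels first: each `F`-neighbour of `w` contributes one, and there are oddly many of
    -- them because `w` differs from `x`.
    admissible-odd : ⨁ arcs (λ a → ⨁ labels (λ c′ → does (admissible? (w , ps) a c′))) ≡ true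
    admissible-odd = begin
      ⨁ arcs (λ a → ⨁ labels (λ c′ → term c′ a))
        ≡⟨ ⨁-swap arcs labels (λ a c′ → term c′ a) ⟩
      ⨁ arcs (term nothing) xor ⨁ (map just (allFin n)) (λ c′ → ⨁ arcs (term c′))
        ≡⟨ cong₂ _xor_ row-nothing (⨁-map just (allFin n) _) ⟩
      ⨁ (allFin n) (λ u → ⨁ arcs (term (just u)))
        ≡⟨ ⨁-cong (allFin n) row-just ⟩
      ⨁ (allFin n) (F w)
        ≡⟨ F-odd start≢ ⟩
      true ∎
      where open ≡-Reasoning

    rotations-closings :
      ⨁ (upTo ℓ) (λ j → ⨁ labels (λ c′ → does (valid? (rotate j c′ (w , ps)))))
        xor ⨁ labels (λ c′ → does (admissible? (w , ps) (nothing , x) c′)) ≡ true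
    rotations-closings = begin
      ⨁ (upTo ℓ) g xor closings
        ≡⟨ cong (λ k → ⨁ (upTo k) g xor closings) (sym length≡) ⟩
      ⨁ (upTo (length ps)) g xor closings
        ≡⟨ cong (_xor closings) (⨁-positions ps g _ at) ⟩
      ⨁ ps h xor closings
        ≡⟨ xor-comm (⨁ ps h) closings ⟩
      ⨁ arcs h
        ≡⟨ admissible-odd ⟩
      true ∎
      where
      open ≡-Reasoning
      g : ℕ → Bool
      g j = ⨁ labels (λ c′ → does (valid? (rotate j c′ (w , ps))))
      h : Arc → Bool
      h a = ⨁ labels (λ c′ → does (admissible? (w , ps) a c′))
      closings = ⨁ labels (λ c′ → does (admissible? (w , ps) (nothing , x) c′))
      at : ∀ as a bs → ps ≡ as ++ a ∷ bs → g (length as) ≡ h a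
      at as (c , z) bs refl = ⨁-cong labels λ c′ →
        does-⇔ (rotate-valid w as c z bs c′ V) (valid? (rotate (length as) c′ (w , ps))) (admissible? (w , ps) (c , z) c′)

  -- P determines Q up to the label at position j, and that label can be read off Q:
  -- this makes the relation visibly symmetric.
  Rotates : ℕ → Path → Path → Set
  Rotates j P Q = Valid P × Valid Q × rotate j (label j Q) P ≡ Q

  rotates? : ∀ j P Q → Dec (Rotates j P Q)
  rotates? j P Q = valid? P ×-dec valid? Q ×-dec (rotate j (label j Q) P ≟ᴾ Q)

  within : ∀ {j P} → j < ℓ → Valid P → j < length (proj₂ P)
  within j<ℓ V = ℕ.≤-trans j<ℓ (ℕ.≤-reflexive (sym (Valid.length≡ V)))

  Rotates-sym : ∀ {j P Q} → j < ℓ → Rotates j P Q → Rotates j Q P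
  Rotates-sym {j} {P} {Q} j<ℓ (VP , VQ , eq) = VQ , VP ,
    trans (cong (rotate j (label j P)) (sym eq)) (rotate-rotate j _ P (within j<ℓ VP))

  -- At position `0`, restoring the old label is the identity. At a positive position the rotated
  -- path starts at a node from behind `w`, and `w` does not occur there.
  Rotates-refl⇔ : ∀ {j P} → j < ℓ → Valid P → Rotates j P P ⇔ 0 ≡ j
  Rotates-refl⇔ {zero}  {w , []}     j<ℓ V with () ← Valid.length≡ V
  Rotates-refl⇔ {zero}  {w , _ ∷ ps} j<ℓ V = mk⇔ (λ _ → refl) (λ _ → V , V , refl)
  Rotates-refl⇔ {suc j} {w , []}     j<ℓ V with () ← Valid.length≡ V
  Rotates-refl⇔ {suc j} {w , a ∷ ps} j<ℓ V = mk⇔ (λ (_ , _ , eq) → contradiction (moved (cong proj₁ eq)) w∉) (λ ())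
    where
    w∉ : ¬ (w ∈ map proj₂ (a ∷ ps))
    w∉ w∈ = occ-repeat Fin._≟_ w _ w∈
      (ℕ.≤-trans (occ-∷-≤ Fin._≟_ w x (w ∷ map proj₂ (a ∷ ps))) (ℕ.≤-reflexive (Valid.once V w)))
    take-⊆ : ∀ {v} j (qs : List Arc) → v ∈ map proj₂ (take j qs) → v ∈ map proj₂ qs
    take-⊆ (suc j) (q ∷ qs) (here eq) = here eq
    take-⊆ (suc j) (q ∷ qs) (there i) = there (take-⊆ j qs i)
    moved : proj₁ (rotate (suc j) (label (suc j) (w , a ∷ ps)) (w , a ∷ ps)) ≡ w → w ∈ map proj₂ (a ∷ ps)
    moved eq = take-⊆ (suc j) (a ∷ ps) (subst (_∈ map proj₂ (a ∷ take j ps)) eq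
                 (first-revOnto w a (take j ps) _))

  -- Summation over all paths.

  validᵇ : Path → Bool
  validᵇ P = does (valid? P)

  -- The label of a rotation can be read off its result, so summing over results or over labels is
  -- the same.
  row-sum : ∀ {j P} → j < ℓ → Valid P →
    ⨁ (paths ℓ) (λ Q → does (rotates? j P Q)) ≡ ⨁ labels (λ c → validᵇ (rotate j c P))
  row-sum {j} {P} j<ℓ V = begin
    ⨁ (paths ℓ) (λ Q → does (rotates? j P Q))
      ≡⟨ ⨁-cong (paths ℓ) (λ Q → sym (trans (⨁-cong labels (at Q))
           (⨁-select _≟ᴸ_ labels (label j Q) (λ _ → does (rotates? j P Q)) (labels-odd (label j Q))))) ⟩
    ⨁ (paths ℓ) (λ Q → ⨁ labels (λ c → does (rotate j c P ≟ᴾ Q) ∧ validᵇ Q))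
      ≡⟨ ⨁-swap (paths ℓ) labels _ ⟩
    ⨁ labels (λ c → ⨁ (paths ℓ) (λ Q → does (rotate j c P ≟ᴾ Q) ∧ validᵇ Q))
      ≡⟨ ⨁-cong labels (λ c → ⨁-select _≟ᴾ_ (paths ℓ) (rotate j c P) validᵇ
           (subst (λ k → OddIn _≟ᴾ_ (paths k) (rotate j c P))
             (trans (length-rotate j c P) (Valid.length≡ V)) (paths-odd (rotate j c P)))) ⟩
    ⨁ labels (λ c → validᵇ (rotate j c P)) ∎
    where
    open ≡-Reasoning
    at : ∀ Q c → does (rotate j c P ≟ᴾ Q) ∧ validᵇ Q ≡ does (label j Q ≟ᴸ c) ∧ does (rotates? j P Q)
    at Q c = does-⇔ (mk⇔
      (λ { (refl , VQ) → label-rotate j c P (within j<ℓ V) , V , VQ ,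
             cong (λ d → rotate j d P) (label-rotate j c P (within j<ℓ V)) })
      (λ { (refl , _ , VQ , eq) → eq , VQ }))
      ((rotate j c P ≟ᴾ Q) ×-dec valid? Q) ((label j Q ≟ᴸ c) ×-dec rotates? j P Q)

  rotations : Path → Bool
  rotations P = ⨁ (upTo ℓ) (λ j → ⨁ labels (λ c → validᵇ (rotate j c P)))

  closings : Path → Bool
  closings P = ⨁ labels (λ c → does (admissible? P (nothing , x) c))

  -- For each `j` the relation `Rotates j` is symmetric, so modulo 2 only its diagonal counts. On
  -- the diagonal only `j` equal to `0` remains, once for each valid path.
  rotation-parity : ⨁ (paths ℓ) (λ P → validᵇ P ∧ rotations P) ≡ ⨁ (paths ℓ) validᵇ
  rotation-parity = begin
    ⨁ (paths ℓ) (λ P → validᵇ P ∧ rotations P)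
      ≡⟨ ⨁-cong (paths ℓ) row ⟩
    ⨁ (paths ℓ) (λ P → ⨁ (upTo ℓ) (λ j → ⨁ (paths ℓ) (λ Q → does (rotates? j P Q))))
      ≡⟨ ⨁-swap (paths ℓ) (upTo ℓ) _ ⟩
    ⨁ (upTo ℓ) (λ j → ⨁ (paths ℓ) (λ P → ⨁ (paths ℓ) (λ Q → does (rotates? j P Q))))
      ≡⟨ ⨁-cong∈ (upTo ℓ) (λ {j} j∈ → ⨁-diagonal (paths ℓ) _ λ P Q →
           does-⇔ (mk⇔ (Rotates-sym (∈-upTo⁻ j∈)) (Rotates-sym (∈-upTo⁻ j∈))) (rotates? j P Q) (rotates? j Q P)) ⟩
    ⨁ (upTo ℓ) (λ j → ⨁ (paths ℓ) (λ P → does (rotates? j P P)))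
      ≡⟨ ⨁-swap (upTo ℓ) (paths ℓ) _ ⟩
    ⨁ (paths ℓ) (λ P → ⨁ (upTo ℓ) (λ j → does (rotates? j P P)))
      ≡⟨ ⨁-cong (paths ℓ) diagonal ⟩
    ⨁ (paths ℓ) validᵇ ∎
    where
    open ≡-Reasoning
    row : ∀ P → validᵇ P ∧ rotations P ≡ ⨁ (upTo ℓ) (λ j → ⨁ (paths ℓ) (λ Q → does (rotates? j P Q)))
    row P = by (valid? P)
      where
      by : Dec (Valid P) → validᵇ P ∧ rotations P ≡ ⨁ (upTo ℓ) (λ j → ⨁ (paths ℓ) (λ Q → does (rotates? j P Q)))
      by (yes V) = trans (cong (_∧ rotations P) (dec-true (valid? P) V))
                         (sym (⨁-cong∈ (upTo ℓ) λ j∈ → row-sum (∈-upTo⁻ j∈) V))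
      by (no ¬V) = trans (cong (_∧ rotations P) (dec-false (valid? P) ¬V))
        (sym (trans (⨁-cong (upTo ℓ) λ j → trans
           (⨁-cong (paths ℓ) λ Q → dec-false (rotates? j P Q) (¬V ∘ proj₁)) (⨁-false (paths ℓ))) (⨁-false (upTo ℓ))))
    diagonal : ∀ P → ⨁ (upTo ℓ) (λ j → does (rotates? j P P)) ≡ validᵇ P
    diagonal P = by (valid? P)
      where
      by : Dec (Valid P) → ⨁ (upTo ℓ) (λ j → does (rotates? j P P)) ≡ validᵇ P
      by (no ¬V) = trans (⨁-cong (upTo ℓ) λ j → dec-false (rotates? j P P) (¬V ∘ proj₁))
                         (trans (⨁-false (upTo ℓ)) (sym (dec-false (valid? P) ¬V)))
      by (yes V) = trans (⨁-cong∈ (upTo ℓ) λ {j} j∈ →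
                           does-⇔ (Rotates-refl⇔ (∈-upTo⁻ j∈) V) (rotates? j P P) (0 ℕ.≟ j))
        (trans (⨁-upTo (λ j → does (0 ℕ.≟ j)) ℓ′) (trans (cong not (⨁-false (upTo ℓ′))) (sym (dec-true (valid? P) V))))

  -- Rotations and closings together are odd for each valid path, and rotations alone already have
  -- the parity of the number of valid paths.
  closing-parity : ⨁ (paths ℓ) (λ P → validᵇ P ∧ closings P) ≡ false
  closing-parity = cancel (begin
    ⨁ (paths ℓ) validᵇ xor ⨁ (paths ℓ) (λ P → validᵇ P ∧ closings P)
      ≡⟨ cong (_xor ⨁ (paths ℓ) (λ P → validᵇ P ∧ closings P)) (sym rotation-parity) ⟩
    ⨁ (paths ℓ) (λ P → validᵇ P ∧ rotations P) xor ⨁ (paths ℓ) (λ P → validᵇ P ∧ closings P)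
      ≡⟨ sym (⨁-xor (paths ℓ) _ _) ⟩
    ⨁ (paths ℓ) (λ P → (validᵇ P ∧ rotations P) xor (validᵇ P ∧ closings P))
      ≡⟨ ⨁-cong (paths ℓ) (λ P → trans (sym (∧-distribˡ-xor (validᵇ P) _ _)) (by P (valid? P))) ⟩
    ⨁ (paths ℓ) validᵇ ∎)
    where
    open ≡-Reasoning
    cancel : ∀ {p q} → p xor q ≡ p → q ≡ false
    cancel {false} eq = eq
    cancel {true} {false} eq = refl
    by : ∀ P → Dec (Valid P) → validᵇ P ∧ (rotations P xor closings P) ≡ validᵇ P
    by P (yes V) = trans (cong (validᵇ P ∧_) (rotations-closings V)) (∧-identityʳ _)
    by P (no ¬V) = trans (cong (_∧ (rotations P xor closings P)) (dec-false (valid? P) ¬V))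
                         (sym (dec-false (valid? P) ¬V))

  -- Closings with and without outer nodes.

  Closed : Path → Label → Set
  Closed P c = Valid P × Admissible P (nothing , x) c

  closed? : ∀ P c → Dec (Closed P c)
  closed? P c = valid? P ×-dec admissible? P (nothing , x) c

  -- The closing, including its last connection `c`, runs along edges of H alone.
  Plain : Path → Label → Set
  Plain (w , ps) c = All (nothing ≡_) (c ∷ map proj₁ ps)

  plain? : ∀ P c → Dec (Plain P c)
  plain? (w , ps) c = All.all? (nothing ≟ᴸ_) (c ∷ map proj₁ ps)

  ¬plain⇒just : ∀ cs → ¬ All (nothing ≡_) cs → Σ[ u ∈ Fin n ] just u ∈ cs
  ¬plain⇒just []             ¬p = contradiction [] ¬p
  ¬plain⇒just (just u  ∷ cs) ¬p = u , here refl
  ¬plain⇒just (nothing ∷ cs) ¬p with ¬plain⇒just cs (λ p → ¬p (refl ∷ p))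
  ... | u , i = u , there i

  total : (Path → Label → Bool) → Bool
  total f = ⨁ (paths ℓ) (λ P → ⨁ labels (f P))

  total-xor : ∀ f g → total (λ P c → f P c xor g P c) ≡ total f xor total g
  total-xor f g = trans (⨁-cong (paths ℓ) (λ P → ⨁-xor labels (f P) (g P)))
                        (⨁-xor (paths ℓ) (λ P → ⨁ labels (f P)) (λ P → ⨁ labels (g P)))

  total-true : ∀ f → total f ≡ true → ∃[ P ] ∃[ c ] f P c ≡ true
  total-true f eq with ⨁-true (paths ℓ) (λ P → ⨁ labels (f P)) eq
  ... | P , eq′ with ⨁-true labels (f P) eq′
  ... | c , eq″ = P , c , eq″

  closed-even : total (λ P c → does (closed? P c)) ≡ false
  closed-even = trans (⨁-cong (paths ℓ) (λ P → ⨁-∧ labels (validᵇ P) (λ c → does (admissible? P (nothing , x) c))))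
                      closing-parity

  module _ (P₀ : Path) (C₀ : Closed P₀ nothing) (p₀ : Plain P₀ nothing)
    (unique : ∀ {P} → Closed P nothing → Plain P nothing → P₀ ≡ P) where

    private
      plain nonplain : Path → Label → Bool
      plain    P c = does (closed? P c) ∧ does (plain? P c)
      nonplain P c = does (closed? P c) ∧ not (does (plain? P c))

    plain-odd : total plain ≡ true
    plain-odd = begin
      total plain
        ≡⟨ ⨁-cong (paths ℓ) (λ P → trans (⨁-cong labels (only P))
             (⨁-∧ labels (does (P₀ ≟ᴾ P)) (λ c → does (nothing ≟ᴸ c)))) ⟩
      ⨁ (paths ℓ) (λ P → does (P₀ ≟ᴾ P) ∧ ⨁ labels (λ c → does (nothing ≟ᴸ c)))
        ≡⟨ ⨁-select _≟ᴾ_ (paths ℓ) P₀ (λ _ → ⨁ labels (λ c → does (nothing ≟ᴸ c)))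
             (subst (λ k → OddIn _≟ᴾ_ (paths k) P₀) (Valid.length≡ (proj₁ C₀)) (paths-odd P₀)) ⟩
      ⨁ labels (λ c → does (nothing ≟ᴸ c))
        ≡⟨ labels-odd nothing ⟩
      true ∎
      where
      open ≡-Reasoning
      only : ∀ P c → plain P c ≡ does (P₀ ≟ᴾ P) ∧ does (nothing ≟ᴸ c)
      only P c = does-⇔ (mk⇔ (λ { (C , p@(refl ∷ _)) → unique C p , refl }) (λ { (refl , refl) → C₀ , p₀ }))
                   (closed? P c ×-dec plain? P c) ((P₀ ≟ᴾ P) ×-dec (nothing ≟ᴸ c))

    -- The number of closings is even, and exactly one of them is plain.
    nonplain-odd : total nonplain ≡ true
    nonplain-odd = cancel (begin
      true xor total nonplain        ≡⟨ cong (_xor total nonplain) (sym plain-odd) ⟩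
      total plain xor total nonplain ≡⟨ sym (total-xor plain nonplain) ⟩
      total (λ P c → plain P c xor nonplain P c)
        ≡⟨ ⨁-cong (paths ℓ) (λ P → ⨁-cong labels (λ c →
             xor-split (does (closed? P c)) (does (plain? P c)))) ⟩
      total (λ P c → does (closed? P c)) ≡⟨ closed-even ⟩
      false ∎)
      where
      open ≡-Reasoning
      cancel : ∀ {p} → true xor p ≡ false → p ≡ true
      cancel {true} eq = refl
      xor-split : ∀ p q → (p ∧ q) xor (p ∧ not q) ≡ p
      xor-split false q     = refl
      xor-split true  false = refl
      xor-split true  true  = refl

    another-closing : ∃[ P ] ∃[ c ] Closed P c × Σ[ u ∈ Fin n ] just u ∈ (c ∷ map proj₁ (proj₂ P))
    another-closing = extract (total-true nonplain nonplain-odd)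
      where
      extract : ∃[ P ] ∃[ c ] nonplain P c ≡ true →
        ∃[ P ] ∃[ c ] Closed P c × Σ[ u ∈ Fin n ] just u ∈ (c ∷ map proj₁ (proj₂ P))
      extract (P , c , eq) = P , c , proj₁ both , ¬plain⇒just (c ∷ map proj₁ (proj₂ P)) (proj₂ both)
        where both = does⇒ (closed? P c ×-dec ¬? (plain? P c)) eq

xor-true : ∀ p q → p xor q ≡ true → p ≡ true ⊎ q ≡ true
xor-true true  q    _  = inj₁ refl
xor-true false true _  = inj₂ refl

-- Parity subgraphs from walks

-- The adjacency matrix modulo 2 of the single edge between `s` and `t`.
edge : (s t a b : Fin n) → Bool
edge s t a b = (does (a Fin.≟ s) ∧ does (b Fin.≟ t)) xor (does (a Fin.≟ t) ∧ does (b Fin.≟ s))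

edge-sym : ∀ (s t a b : Fin n) → edge s t a b ≡ edge s t b a
edge-sym s t a b = trans (xor-comm (does (a Fin.≟ s) ∧ does (b Fin.≟ t)) _)
  (cong₂ _xor_ (∧-comm (does (a Fin.≟ t)) _) (∧-comm (does (a Fin.≟ s)) _))

edge-true : ∀ (s t a b : Fin n) → edge s t a b ≡ true → (a ≡ s × b ≡ t) ⊎ (a ≡ t × b ≡ s)
edge-true s t a b eq with xor-true _ _ eq
... | inj₁ p = inj₁ (does⇒ ((a Fin.≟ s) ×-dec (b Fin.≟ t)) p)
... | inj₂ p = inj₂ (does⇒ ((a Fin.≟ t) ×-dec (b Fin.≟ s)) p)

indicator-sum : (t : Fin n) → ⨁ (allFin n) (λ b → does (b Fin.≟ t)) ≡ true
indicator-sum {n} t = trans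
  (⨁-cong (allFin n) λ b → does-⇔ (mk⇔ sym sym) (b Fin.≟ t) (t Fin.≟ b)) (allFin-odd t)

edge-degree : ∀ (s t a : Fin n) → ⨁ (allFin n) (edge s t a) ≡ does (a Fin.≟ s) xor does (a Fin.≟ t)
edge-degree {n} s t a = trans (⨁-xor (allFin n) _ _) (cong₂ _xor_ (half s t) (half t s))
  where
  half : ∀ s t → ⨁ (allFin n) (λ b → does (a Fin.≟ s) ∧ does (b Fin.≟ t)) ≡ does (a Fin.≟ s)
  half s t = trans (⨁-∧ (allFin n) (does (a Fin.≟ s)) _)
    (trans (cong (does (a Fin.≟ s) ∧_) (indicator-sum t)) (∧-identityʳ _))

module _ (G : Graph n) where

  -- An edge traversed an even number of times cancels.
  walkEdges : ∀ {s t} → Star (Adj G) s t → Fin n → Fin n → Bool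
  walkEdges ε a b = false
  walkEdges (_◅_ {i = s} {j = r} _ w) a b = edge s r a b xor walkEdges w a b

  walkEdges-sym : ∀ {s t} (w : Star (Adj G) s t) a b → walkEdges w a b ≡ walkEdges w b a
  walkEdges-sym ε a b = refl
  walkEdges-sym (_◅_ {i = s} {j = r} _ w) a b = cong₂ _xor_ (edge-sym s r a b) (walkEdges-sym w a b)

  walkEdges⇒Adj : ∀ {s t} (w : Star (Adj G) s t) a b → walkEdges w a b ≡ true → Adj G a b
  walkEdges⇒Adj (_◅_ {i = s} {j = r} e w) a b eq with xor-true (edge s r a b) _ eq
  ... | inj₂ p = walkEdges⇒Adj w a b p
  ... | inj₁ p with edge-true s r a b p
  ...   | inj₁ (refl , refl) = e
  ...   | inj₂ (refl , refl) = symm G e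

  -- This is the boundary of the walk modulo 2: the contributions of inner nodes telescope.
  walkEdges-degree : ∀ {s t} (w : Star (Adj G) s t) a →
    ⨁ (allFin n) (walkEdges w a) ≡ does (a Fin.≟ s) xor does (a Fin.≟ t)
  walkEdges-degree {s} ε a = trans (⨁-false (allFin n)) (sym (xor-same (does (a Fin.≟ s))))
  walkEdges-degree (_◅_ {i = s} {j = r} {k = t} _ w) a = trans (⨁-xor (allFin n) _ _)
    (trans (cong₂ _xor_ (edge-degree s r a) (walkEdges-degree w a))
      (cancel (does (a Fin.≟ s)) (does (a Fin.≟ r)) (does (a Fin.≟ t))))
    where
    cancel : ∀ p q r → (p xor q) xor (q xor r) ≡ p xor r
    cancel false false r = refl
    cancel false true  r = 𝔹.not-involutive r
    cancel true  false r = refl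
    cancel true  true  r = refl

  -- A T-join, built as the symmetric difference of walks from all `ts` to a common root `r`.
  module Join (connected : Connected G) (ts : List (Fin n)) (r : Fin n) where

    join : Fin n → Fin n → Bool
    join a b = ⨁ ts (λ t → walkEdges (connected t r) a b)

    join-sym : ∀ a b → join a b ≡ join b a
    join-sym a b = ⨁-cong ts λ t → walkEdges-sym (connected t r) a b

    join⇒Adj : ∀ a b → join a b ≡ true → Adj G a b
    join⇒Adj a b eq with ⨁-true ts (λ t → walkEdges (connected t r) a b) eq
    ... | t , p = walkEdges⇒Adj (connected t r) a b p

    join-degree : ∀ a → ⨁ (allFin n) (join a) ≡ ⨁ ts (λ t → does (a Fin.≟ t) xor does (a Fin.≟ r))
    join-degree a = trans (⨁-swap (allFin n) ts _) (⨁-cong ts λ t → walkEdges-degree (connected t r) a)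

-- The cycle order on Fin (3 + q)

prev : Fin (3 + q) → Fin (3 + q)
prev zero    = fromℕ _
prev (suc i) = inject₁ i

next-inject₁ : (i : Fin (2 + q)) → next (inject₁ i) ≡ suc i
next-inject₁ {q} i = Fin.toℕ-injective (trans (Fin.toℕ-fromℕ< _)
  (trans (cong (λ j → suc j % (3 + q)) (Fin.toℕ-inject₁ i)) (m<n⇒m%n≡m (s≤s (Fin.toℕ<n i)))))

next-fromℕ : next (fromℕ (2 + q)) ≡ zero
next-fromℕ {q} = Fin.toℕ-injective (trans (Fin.toℕ-fromℕ< _)
  (trans (cong (λ j → suc j % (3 + q)) (Fin.toℕ-fromℕ (2 + q))) (n%n≡0 (3 + q))))

next-prev : (i : Fin (3 + q)) → next (prev i) ≡ i
next-prev zero    = next-fromℕ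
next-prev (suc i) = next-inject₁ i

prev-next : (i : Fin (3 + q)) → prev (next i) ≡ i
prev-next i with view i
... | ‵fromℕ     = cong prev next-fromℕ
... | ‵inject₁ j = cong prev (next-inject₁ j)

next-injective : {i j : Fin (3 + q)} → next i ≡ next j → i ≡ j
next-injective {i = i} {j} eq = trans (sym (prev-next i)) (trans (cong prev eq) (prev-next j))

-- A cycle has at least three nodes; with two, successor and predecessor would coincide.
next≢prev : (i : Fin (3 + q)) → next i ≢ prev i
next≢prev zero eq with () ← trans (sym (next-inject₁ zero)) eq
next≢prev {q} (suc i) eq with view i
... | ‵fromℕ     with () ← trans (sym next-fromℕ) eq
... | ‵inject₁ j = ℕ.<⇒≢ (ℕ.m≤n⇒m≤1+n (ℕ.n<1+n (toℕ j))) (sym (trans (cong toℕ (trans (sym (next-inject₁ (suc j))) eq))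
                     (trans (Fin.toℕ-inject₁ (inject₁ j)) (Fin.toℕ-inject₁ j))))

-- With _xor_ instead of _∨_ the row sums below are immediate; next i ≡ prev i never
-- occurs, so this is adjacency on the cycle.
ring : (i j : Fin (3 + q)) → Bool
ring i j = does (next i Fin.≟ j) xor does (next j Fin.≟ i)

ring-sym : (i j : Fin (3 + q)) → ring i j ≡ ring j i
ring-sym i j = xor-comm (does (next i Fin.≟ j)) _

ring-irrefl : (i : Fin (3 + q)) → ring i i ≡ false
ring-irrefl i = xor-same (does (next i Fin.≟ i))

-- The two tests in `ring` contribute one neighbour each, the successor and the predecessor of `i`.
ring-even : (i : Fin (3 + q)) → ⨁ (allFin (3 + q)) (ring i) ≡ false
ring-even {q} i = trans (⨁-xor (allFin (3 + q)) (λ j → does (next i Fin.≟ j)) (λ j → does (next j Fin.≟ i)))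
  (cong₂ _xor_ (allFin-odd (next i))
  (trans (⨁-cong (allFin (3 + q)) λ j → does-⇔ (mk⇔ (λ { refl → prev-next j }) (λ { refl → next-prev i }))
            (next j Fin.≟ i) (prev i Fin.≟ j))
         (allFin-odd (prev i))))

ring⁻ : (i j : Fin (3 + q)) → ring i j ≡ true → next i ≡ j ⊎ next j ≡ i
ring⁻ i j eq with xor-true (does (next i Fin.≟ j)) _ eq
... | inj₁ p = inj₁ (does⇒ (next i Fin.≟ j) p)
... | inj₂ p = inj₂ (does⇒ (next j Fin.≟ i) p)

ring-next : (i : Fin (3 + q)) → ring i (next i) ≡ true
ring-next i = cong₂ _xor_ (dec-true (next i Fin.≟ next i) refl)
  (dec-false (next (next i) Fin.≟ i) λ eq → next≢prev i (trans (sym (prev-next (next i))) (cong prev eq)))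

-- The parity subgraph of the bipartite graph.

module Terminals {V U : Subset n} (H : Cycle n) (Gb : BipartiteGraph V U)
  (onV : HasNodeSet H V) (connected : Connected (graph Gb)) where

  m = 3 + k H

  node∈V : ∀ i → node H i ∈ˢ V
  node∈V i = Equivalence.to (onV (node H i)) (i , refl)

  V⇒node : ∀ {a} → a ∈ˢ V → ∃[ i ] node H i ≡ a
  V⇒node {a} = Equivalence.from (onV a)

  V∩U-empty : ∀ {a} → a ∈ˢ V → a ∉ˢ U
  V∩U-empty a∈V a∈U = disjoint Gb (_ , x∈p∩q⁺ (a∈V , a∈U))

  crosses : ∀ {a b} → Adj (graph Gb) a b → a ∈ˢ V → b ∉ˢ V
  crosses e a∈V b∈V with crossing Gb e
  ... | inj₁ (_ , b∈U) = V∩U-empty b∈V b∈U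
  ... | inj₂ (a∈U , _) = V∩U-empty a∈V a∈U

  crosses⁻ : ∀ {a b} → Adj (graph Gb) a b → b ∉ˢ V → a ∈ˢ V
  crosses⁻ e b∉V with crossing Gb e
  ... | inj₁ (a∈V , _) = a∈V
  ... | inj₂ (_ , b∈V) = contradiction b∈V b∉V

  -- One walk from every node of V to the root. The walk from the root to itself is closed and
  -- changes no degree modulo 2.
  open Join (graph Gb) connected (map (node H) (allFin m)) (node H zero)

  F : Fin m → Fin n → Bool
  F i u = join (node H i) u

  F⇒Adj : ∀ i u → F i u ≡ true → Adj (graph Gb) (node H i) u
  F⇒Adj i u = join⇒Adj (node H i) u

  F⇒∉V : ∀ i u → F i u ≡ true → u ∉ˢ V
  F⇒∉V i u eq = crosses (F⇒Adj i u eq) (node∈V i)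

  node-indicator : ∀ i j → does (node H i Fin.≟ node H j) ≡ does (i Fin.≟ j)
  node-indicator i j = does-⇔ (mk⇔ (Cycle.injective H) (cong (node H))) (node H i Fin.≟ node H j) (i Fin.≟ j)

  degree : ∀ a → ⨁ (allFin n) (join a) ≡ ⨁ (allFin m) (λ j → does (a Fin.≟ node H j) xor does (a Fin.≟ node H zero))
  degree a = trans (join-degree a) (⨁-map (node H) (allFin m) (λ t → does (a Fin.≟ t) xor does (a Fin.≟ node H zero)))

  -- Away from the root, exactly one walk has odd degree at a node of V: the one that starts there.
  F-odd : ∀ {i} → i ≢ zero → ⨁ (allFin n) (F i) ≡ true
  F-odd {i} i≢0 = trans (degree (node H i)) (trans (⨁-cong (allFin m) {g = λ j → does (i Fin.≟ j)} λ j → trans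
    (cong₂ _xor_ (node-indicator i j) (dec-false (node H i Fin.≟ node H zero) (i≢0 ∘ Cycle.injective H)))
    (xor-identityʳ _)) (allFin-odd i))

  -- For `u` in V there is nothing to count, since edges of the bipartite graph leave V. For `u`
  -- outside V no walk starts or ends at `u`, so its degree is even, and as all its neighbours lie
  -- in V the sum over V is the whole degree.
  F-even : ∀ u → ⨁ (allFin m) (λ i → F i u) ≡ false
  F-even u with u ∈? V
  ... | yes u∈V = trans (⨁-cong (allFin m) λ i → 𝔹.¬-not λ eq → F⇒∉V i u eq u∈V) (⨁-false (allFin m))
  ... | no  u∉V = begin
    ⨁ (allFin m) (λ i → join (node H i) u)
      ≡⟨ ⨁-cong (allFin m) (λ i → sym
           (⨁-select Fin._≟_ (allFin n) (node H i) (λ a → join a u) (allFin-odd (node H i)))) ⟩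
    ⨁ (allFin m) (λ i → ⨁ (allFin n) (λ a → does (node H i Fin.≟ a) ∧ join a u))
      ≡⟨ ⨁-swap (allFin m) (allFin n) _ ⟩
    ⨁ (allFin n) (λ a → ⨁ (allFin m) (λ i → does (node H i Fin.≟ a) ∧ join a u))
      ≡⟨ ⨁-cong (allFin n) column ⟩
    ⨁ (allFin n) (λ a → join a u)
      ≡⟨ ⨁-cong (allFin n) (λ a → join-sym a u) ⟩
    ⨁ (allFin n) (join u)
      ≡⟨ degree u ⟩
    ⨁ (allFin m) (λ j → does (u Fin.≟ node H j) xor does (u Fin.≟ node H zero))
      ≡⟨ ⨁-cong (allFin m) (λ j → cong₂ _xor_ (u≢node j) (u≢node zero)) ⟩
    ⨁ (allFin m) (λ _ → false)
      ≡⟨ ⨁-false (allFin m) ⟩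
    false ∎
    where
    open ≡-Reasoning
    u≢node : ∀ j → does (u Fin.≟ node H j) ≡ false
    u≢node j = dec-false (u Fin.≟ node H j) λ eq → u∉V (subst (_∈ˢ V) (sym eq) (node∈V j))
    column : ∀ a → ⨁ (allFin m) (λ i → does (node H i Fin.≟ a) ∧ join a u) ≡ join a u
    column a = by (join a u) refl
      where
      by : ∀ b → join a u ≡ b → ⨁ (allFin m) (λ i → does (node H i Fin.≟ a) ∧ join a u) ≡ join a u
      by false eq = trans (⨁-cong (allFin m) λ i → trans (cong (does (node H i Fin.≟ a) ∧_) eq) (∧-zeroʳ _))
                          (trans (⨁-false (allFin m)) (sym eq))
      by true  eq with V⇒node (crosses⁻ (join⇒Adj a u eq) u∉V)
      ... | i , refl = trans (⨁-cong (allFin m) λ j → cong (_∧ join a u)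
                         (does-⇔ (mk⇔ (λ eq → Cycle.injective H (sym eq)) (λ eq → cong (node H) (sym eq)))
                           (node H j Fin.≟ a) (i Fin.≟ j)))
                       (⨁-select Fin._≟_ (allFin m) i (λ _ → join a u) (allFin-odd i))

-- From closed paths to cycles

lookup-injective : (_≟_ : DecidableEquality A) (xs : List A) → (∀ x → occ _≟_ x xs ≤ 1) →
  ∀ {i j} → lookup xs i ≡ lookup xs j → i ≡ j
lookup-injective _≟_ (x ∷ xs) once {zero}  {zero}  eq = refl
lookup-injective _≟_ (x ∷ xs) once {zero}  {suc j} eq =
  contradiction (once x) (occ-repeat _≟_ x xs (subst (_∈ xs) (sym eq) (∈-lookup j)))
lookup-injective _≟_ (x ∷ xs) once {suc i} {zero}  eq = sym (lookup-injective _≟_ (x ∷ xs) once {zero} {suc i} (sym eq))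
lookup-injective _≟_ (x ∷ xs) once {suc i} {suc j} eq =
  cong suc (lookup-injective _≟_ xs (λ y → ℕ.≤-trans (occ-∷-≤ _≟_ y x xs) (once y)) eq)

-- The last step leads to `b`, which is not in the list; with `b` equal to `a` this is a closed walk
-- that names its start once.
Chain : Rel A 0ℓ → A → List A → A → Set
Chain R a []       b = R a b
Chain R a (v ∷ vs) b = R a v × Chain R v vs b

Chain-step : (R : Rel A 0ℓ) → ∀ a vs {b} → Chain R a vs b → (i : Fin (length vs)) →
  R (lookup (a ∷ vs) (inject₁ i)) (lookup vs i)
Chain-step R a (v ∷ vs) (r , c) zero    = r
Chain-step R a (v ∷ vs) (r , c) (suc i) = Chain-step R v vs c i

Chain-last : (R : Rel A 0ℓ) → ∀ a vs {b} → Chain R a vs b → R (lookup (a ∷ vs) (fromℕ (length vs))) b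
Chain-last R a []       r       = r
Chain-last R a (v ∷ vs) (_ , c) = Chain-last R v vs c

module FromList (G : Graph n) (a b c : Fin n) (vs : List (Fin n))
  (chain : Chain (Adj G) a (b ∷ c ∷ vs) a)
  (once : ∀ t → occ Fin._≟_ t (a ∷ b ∷ c ∷ vs) ≤ 1) where

  cycle : Cycle n
  cycle = record
    { k = length vs ; node = lookup (a ∷ b ∷ c ∷ vs) ; injective = lookup-injective Fin._≟_ (a ∷ b ∷ c ∷ vs) once }

  step : ∀ i → Adj G (node cycle i) (node cycle (next i))
  step i with view i
  ... | ‵fromℕ     = subst (λ j → Adj G (node cycle (fromℕ _)) (node cycle j)) (sym next-fromℕ)
                       (Chain-last (Adj G) a (b ∷ c ∷ vs) chain)
  ... | ‵inject₁ j = subst (λ j′ → Adj G (node cycle (inject₁ j)) (node cycle j′)) (sym (next-inject₁ j))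
                       (Chain-step (Adj G) a (b ∷ c ∷ vs) chain j)

  isCycleOf : cycle IsCycleOf G
  isCycleOf (inj₁ (i , refl , refl)) = step i
  isCycleOf (inj₂ (i , refl , refl)) = symm G (step i)

  on : ∀ {t} → t ∈ a ∷ b ∷ c ∷ vs → t IsOn cycle
  on t∈ = index t∈ , sym (lookup-index t∈)

cycleFromList : (G : Graph n) (a : Fin n) (vs : List (Fin n)) → 2 ≤ length vs →
  Chain (Adj G) a vs a → (∀ t → occ Fin._≟_ t (a ∷ vs) ≤ 1) →
  Σ[ d ∈ Cycle n ] d IsCycleOf G × (∀ {t} → t ∈ a ∷ vs → t IsOn d)
cycleFromList G a (b ∷ c ∷ vs) _ chain once = cycle , isCycleOf , on
  where open FromList G a b c vs chain once
cycleFromList G a (b ∷ []) (s≤s ()) chain once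

-- The second cycle.

module SecondCycle {V U : Subset n} (H : Cycle n) (Gb : BipartiteGraph V U)
  (onV : HasNodeSet H V) (connected : Connected (graph Gb)) where

  open Terminals H Gb onV connected
  -- Here `x` is node 0 of H and `y` its last node. A path with `1 + k H` arcs has `2 + k H` nodes,
  -- which together with `x` are all `3 + k H` nodes of H.
  open Parity ring ring-sym F ring-irrefl ring-even F-even zero (fromℕ (2 + k H)) F-odd (k H)

  G : Graph n
  G = cycleGraph H ∪ᴳ graph Gb

  direct : Fin m → Arc
  direct v = nothing , v

  -- H itself, traversed from node 1 up to the last node.
  P₀ : Path
  P₀ = suc zero , tabulate {n = suc (k H)} (λ i → direct (suc (suc i)))

  P₀-labels : All (nothing ≡_) (map proj₁ (proj₂ P₀))
  P₀-labels = plain (suc (k H)) (λ i → suc (suc i))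
    where
    plain : ∀ l (f : Fin l → Fin m) → All (nothing ≡_) (map proj₁ (tabulate (direct ∘ f)))
    plain zero    f = []
    plain (suc l) f = refl ∷ plain l (f ∘ suc)

  plain⇒unused : ∀ {ps : List Arc} u → All (nothing ≡_) (map proj₁ ps) → uses u ps ≡ 0
  plain⇒unused {[]}     u []         = refl
  plain⇒unused {p ∷ ps} u (refl ∷ a) = plain⇒unused {ps} u a

  P₀-closed : Closed P₀ nothing
  P₀-closed = record
    { length≡ = length-tabulate {n = suc (k H)} (λ i → direct (suc (suc i)))
    ; once    = λ v → trans
        (cong (λ vs → visits v (zero ∷ suc zero ∷ vs))
          (map-tabulate {n = suc (k H)} (λ i → direct (suc (suc i))) proj₂))
        (occ-allFin v)
    ; end≡    = end-tabulate (suc zero) (k H) (λ i → suc (suc i))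
    ; links   = links-tabulate (suc zero) (k H) (λ i → suc (suc i))
        (ring-suc (suc zero)) (λ i → ring-suc (suc (suc i)))
    ; simple  = λ u → ℕ.≤-trans (ℕ.≤-reflexive (unused u)) z≤n
    } , trans (ring-sym {k H} (suc zero) zero) (ring-suc zero) ,
    λ u → ℕ.≤-trans (ℕ.≤-reflexive (trans (ℕ.+-identityʳ (uses u (proj₂ P₀))) (unused u))) z≤n
    where
    unused : ∀ u → uses u (proj₂ P₀) ≡ 0
    unused u = plain⇒unused {proj₂ P₀} u P₀-labels
    ring-suc : ∀ (i : Fin (2 + k H)) → ring (inject₁ i) (suc i) ≡ true
    ring-suc i = subst (λ j → ring (inject₁ i) j ≡ true) (next-inject₁ i) (ring-next (inject₁ i))
    end-tabulate : ∀ w l (f : Fin (suc l) → Fin m) → end w (tabulate (direct ∘ f)) ≡ f (fromℕ l)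
    end-tabulate w zero    f = refl
    end-tabulate w (suc l) f = end-tabulate (f zero) l (f ∘ suc)
    links-tabulate : ∀ w l (f : Fin (suc l) → Fin m) → ring w (f zero) ≡ true →
      (∀ i → ring (f (inject₁ i)) (f (suc i)) ≡ true) → Links w (tabulate (direct ∘ f))
    links-tabulate w zero    f r rs = r , tt
    links-tabulate w (suc l) f r rs = r , links-tabulate (f zero) l (f ∘ suc) (rs zero) (rs ∘ suc)

  -- The path follows H in the direction of `next`; its start and length then determine it.
  Ascending : Fin m → List Arc → Set
  Ascending w []             = ⊤
  Ascending w ((c , v) ∷ ps) = c ≡ nothing × v ≡ next w × Ascending v ps

  Ascending-unique : ∀ w ps qs → length ps ≡ length qs → Ascending w ps → Ascending w qs → ps ≡ qs
  Ascending-unique w []       []       _  _ _ = refl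
  Ascending-unique w (_ ∷ ps) (_ ∷ qs) eq (refl , refl , a) (refl , refl , b) =
    cong (_ ∷_) (Ascending-unique (next w) ps qs (ℕ.suc-injective eq) a b)

  -- Coming from `a`, a step backwards on H would return to `a`, which has been visited. So the
  -- direction of the first step persists.
  ascending : ∀ a w ps → w ≡ next a → Links w ps → All (nothing ≡_) (map proj₁ ps) →
    (∀ v → visits v (a ∷ w ∷ map proj₂ ps) ≤ 1) → Ascending w ps
  ascending a w []             eq _        _          _    = tt
  ascending a w ((c , v) ∷ ps) eq (l , ls) (refl ∷ p) once with ring⁻ w v l
  ... | inj₁ nw≡v = refl , sym nw≡v , ascending w v ps (sym nw≡v) ls p
                      (λ t → ℕ.≤-trans (occ-∷-≤ Fin._≟_ t a (w ∷ v ∷ map proj₂ ps)) (once t))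
  ... | inj₂ nv≡w = contradiction (once a) (occ-repeat Fin._≟_ a (w ∷ v ∷ map proj₂ ps)
                      (there (here (sym (next-injective (trans nv≡w eq))))))

  end∈ : ∀ w p ps → end w (p ∷ ps) ∈ map proj₂ (p ∷ ps)
  end∈ w (c , v) []       = here refl
  end∈ w (c , v) (p ∷ ps) = there (end∈ v p ps)

  -- The closing edge makes `w` the successor or the predecessor of node 0. The predecessor is the
  -- prescribed end, and a path with an arc and without repeated nodes cannot start there as well.
  plain-ascending : ∀ {w ps} → Closed (w , ps) nothing → Plain (w , ps) nothing → w ≡ next zero × Ascending w ps
  plain-ascending {w} {[]}     (V , _)     _           = contradiction (Valid.length≡ V) λ ()
  plain-ascending {w} {p ∷ ps} (V , l , _) (_ ∷ plain) = by (ring⁻ w zero l)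
    where
    once≤ : ∀ v → visits v (zero ∷ w ∷ map proj₂ (p ∷ ps)) ≤ 1
    once≤ v = ℕ.≤-reflexive (Valid.once V v)
    by : next w ≡ zero ⊎ next zero ≡ w → w ≡ next zero × Ascending w (p ∷ ps)
    by (inj₂ n0≡w) = sym n0≡w , ascending zero w (p ∷ ps) (sym n0≡w) (Valid.links V) plain once≤
    by (inj₁ nw≡0) = contradiction (ℕ.≤-trans (occ-∷-≤ Fin._≟_ w zero (w ∷ map proj₂ (p ∷ ps))) (once≤ w))
                                   (occ-repeat Fin._≟_ w (map proj₂ (p ∷ ps)) w∈)
      where
      last≡w : fromℕ (2 + k H) ≡ w
      last≡w = next-injective {i = fromℕ (2 + k H)} {w} (trans (next-fromℕ {k H}) (sym nw≡0))
      w∈ : w ∈ map proj₂ (p ∷ ps)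
      w∈ = subst (_∈ map proj₂ (p ∷ ps)) (trans (Valid.end≡ V) last≡w) (end∈ w p ps)

  P₀-unique : ∀ {P} → Closed P nothing → Plain P nothing → P₀ ≡ P
  P₀-unique {w , ps} C p = same
    (plain-ascending {suc zero} {proj₂ P₀} P₀-closed (refl ∷ P₀-labels))
    (plain-ascending C p)
    where
    same : ∀ {v} → v ≡ next zero × Ascending v (proj₂ P₀) →
      w ≡ next zero × Ascending w ps → (v , proj₂ P₀) ≡ (w , ps)
    same (refl , a) (refl , b) = cong (next zero ,_) (Ascending-unique (next zero) (proj₂ P₀) ps
      (trans (Valid.length≡ (proj₁ P₀-closed)) (sym (Valid.length≡ (proj₁ C)))) a b)

  flatten : List Arc → List (Fin n)
  flatten []                   = []
  flatten ((nothing , v) ∷ ps) = node H v ∷ flatten ps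
  flatten ((just u  , v) ∷ ps) = u ∷ node H v ∷ flatten ps

  flatten-length : ∀ ps → length ps ≤ length (flatten ps)
  flatten-length []                   = z≤n
  flatten-length ((nothing , v) ∷ ps) = s≤s (flatten-length ps)
  flatten-length ((just u  , v) ∷ ps) = s≤s (ℕ.m≤n⇒m≤1+n (flatten-length ps))

  ring⇒Adj : ∀ v w → ring v w ≡ true → Adj G (node H v) (node H w)
  ring⇒Adj v w r with ring⁻ v w r
  ... | inj₁ refl = inj₁ (inj₁ (v , refl , refl))
  ... | inj₂ refl = inj₁ (inj₂ (w , refl , refl))

  via : ∀ u v w → link (just u) v w ≡ true → F v u ≡ true × F w u ≡ true
  via u v w l with F v u | F w u
  via u v w l | true | true = refl , refl

  flatten-chain : ∀ v ps {b} → Links v ps → Adj G (node H (end v ps)) b → Chain (Adj G) (node H v) (flatten ps) b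
  flatten-chain v []                   _        e = e
  flatten-chain v ((nothing , w) ∷ ps) (l , ls) e = ring⇒Adj v w l , flatten-chain w ps ls e
  flatten-chain v ((just u  , w) ∷ ps) (l , ls) e with via u v w l
  ... | Fvu , Fwu = inj₂ (F⇒Adj v u Fvu) , inj₂ (symm (graph Gb) (F⇒Adj w u Fwu)) , flatten-chain w ps ls e

  used∉V : ∀ v ps {u} → Links v ps → just u ∈ map proj₁ ps → u ∉ˢ V
  used∉V v ((just u , w) ∷ ps) (l , ls) (here refl) = F⇒∉V v u (proj₁ (via u v w l))
  used∉V v ((_      , w) ∷ ps) (l , ls) (there i)   = used∉V w ps ls i

  -- Nodes of H and intermediate nodes are counted apart, because different conditions on a closed
  -- path bound them.
  occ-flatten : ∀ t ps → occ Fin._≟_ t (flatten ps) ≡ occ Fin._≟_ t (map (node H) (map proj₂ ps)) + uses t ps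
  occ-flatten t []                   = refl
  occ-flatten t ((nothing , v) ∷ ps) = begin
    occ Fin._≟_ t (node H v ∷ flatten ps) ≡⟨ occ-++ Fin._≟_ t [ node H v ] (flatten ps) ⟩
    N + occ Fin._≟_ t (flatten ps)        ≡⟨ cong (N +_) (occ-flatten t ps) ⟩
    N + (M + uses t ps)                   ≡⟨ sym (ℕ.+-assoc N M _) ⟩
    (N + M) + uses t ps                   ≡⟨ cong (_+ uses t ps)
      (sym (occ-++ Fin._≟_ t [ node H v ] (map (node H) (map proj₂ ps)))) ⟩
    occ Fin._≟_ t (map (node H) (v ∷ map proj₂ ps)) + uses t ps ∎
    where
    open ≡-Reasoning
    N = occ Fin._≟_ t [ node H v ]
    M = occ Fin._≟_ t (map (node H) (map proj₂ ps))
  occ-flatten t ((just u , v) ∷ ps) = begin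
    occ Fin._≟_ t (u ∷ node H v ∷ flatten ps)
      ≡⟨ trans (occ-++ Fin._≟_ t [ u ] (node H v ∷ flatten ps))
           (cong (O +_) (occ-++ Fin._≟_ t [ node H v ] (flatten ps))) ⟩
    O + (N + occ Fin._≟_ t (flatten ps))
      ≡⟨ cong (λ r → O + (N + r)) (occ-flatten t ps) ⟩
    O + (N + (M + uses t ps))
      ≡⟨ solve 4 (λ o n m u → o :+ (n :+ (m :+ u)) := (n :+ m) :+ (o :+ u)) refl O N M (uses t ps) ⟩
    (N + M) + (O + uses t ps)
      ≡⟨ cong₂ _+_ (sym (occ-++ Fin._≟_ t [ node H v ] (map (node H) (map proj₂ ps))))
           (trans (cong (_+ uses t ps) (sym (occ-map-inj Fin._≟_ _≟ᴸ_ just (λ { refl → refl }) t [ u ])))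
             (sym (uses-++ t [ just u , v ] ps))) ⟩
    occ Fin._≟_ t (map (node H) (v ∷ map proj₂ ps)) + uses t ((just u , v) ∷ ps) ∎
    where
    open ≡-Reasoning
    open +-*-Solver
    O = occ Fin._≟_ t [ u ]
    N = occ Fin._≟_ t [ node H v ]
    M = occ Fin._≟_ t (map (node H) (map proj₂ ps))

  module Closing {w : Fin m} {ps : List Arc} {c : Label} (C : Closed (w , ps) c)
    {u : Fin n} (u∈ : just u ∈ c ∷ map proj₁ ps) where

    open Valid (proj₁ C)

    arcs : List Arc
    -- The route leaves node 0 by the closing connection; the edge of H from the end of the path
    -- back to node 0 completes it.
    arcs = (c , w) ∷ ps

    route : List (Fin n)
    route = node H zero ∷ flatten arcs

    allLinks : Links zero arcs
    allLinks = trans (link-sym c zero w) (proj₁ (proj₂ C)) , links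

    route-chain : Chain (Adj G) (node H zero) (flatten arcs) (node H zero)
    route-chain = flatten-chain zero arcs allLinks
      (subst (λ v → Adj G (node H v) (node H zero)) (sym end≡)
        (ring⇒Adj (fromℕ (2 + k H)) zero
          (subst (λ v → ring (fromℕ (2 + k H)) v ≡ true) next-fromℕ (ring-next (fromℕ (2 + k H))))))

    occ-route : ∀ t → occ Fin._≟_ t route ≡ occ Fin._≟_ t (map (node H) (zero ∷ vertices (w , ps))) + uses t arcs
    occ-route t = begin
      occ Fin._≟_ t route                    ≡⟨ occ-++ Fin._≟_ t [ node H zero ] (flatten arcs) ⟩
      N + occ Fin._≟_ t (flatten arcs)       ≡⟨ cong (N +_) (occ-flatten t arcs) ⟩
      N + (M + uses t arcs)                  ≡⟨ sym (ℕ.+-assoc N M _) ⟩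
      (N + M) + uses t arcs                  ≡⟨ cong (_+ uses t arcs)
        (sym (occ-++ Fin._≟_ t [ node H zero ] (map (node H) (vertices (w , ps))))) ⟩
      occ Fin._≟_ t (map (node H) (zero ∷ vertices (w , ps))) + uses t arcs ∎
      where
      open ≡-Reasoning
      N = occ Fin._≟_ t [ node H zero ]
      M = occ Fin._≟_ t (map (node H) (vertices (w , ps)))

    visits-V : ∀ {t} → t ∈ˢ V → occ Fin._≟_ t (map (node H) (zero ∷ vertices (w , ps))) ≡ 1
    visits-V {t} t∈V = subst (λ t → occ Fin._≟_ t (map (node H) (zero ∷ vertices (w , ps))) ≡ 1) (proj₂ found)
      (trans (occ-map-inj Fin._≟_ Fin._≟_ (node H) (injective H) i (zero ∷ vertices (w , ps))) (once i))
      where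
      found = V⇒node t∈V
      i     = proj₁ found

    -- A node of V occurs once among the nodes of H and never as a label. Any other node occurs only
    -- as a label, and admissibility of the closing bounds its uses, the closing connection
    -- included.
    route-once : ∀ t → occ Fin._≟_ t route ≤ 1
    route-once t = subst (_≤ 1) (sym (occ-route t)) (by (t ∈? V))
      where
      by : Dec (t ∈ˢ V) → occ Fin._≟_ t (map (node H) (zero ∷ vertices (w , ps))) + uses t arcs ≤ 1
      by (yes t∈V) = ℕ.≤-reflexive (cong₂ _+_ (visits-V t∈V)
                       (∉⇒occ≡0 _≟ᴸ_ {just t} {map proj₁ arcs} λ t∈ → used∉V zero arcs allLinks t∈ t∈V))
      by (no t∉V) = subst (λ o → o + uses t arcs ≤ 1)
        (sym (∉⇒occ≡0 Fin._≟_ {t} {map (node H) (zero ∷ vertices (w , ps))} notNode))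
        (begin
        uses t arcs                                ≡⟨ uses-++ t [ c , w ] ps ⟩
        occ _≟ᴸ_ (just t) [ c ] + uses t ps        ≡⟨ ℕ.+-comm (occ _≟ᴸ_ (just t) [ c ]) _ ⟩
        uses t ps + occ _≟ᴸ_ (just t) [ c ]        ≤⟨ proj₂ (proj₂ C) t ⟩
        1                                          ∎)
        where
        open ℕ.≤-Reasoning
        notNode : t ∉ map (node H) (zero ∷ vertices (w , ps))
        notNode t∈ with ∈-map⁻ (node H) t∈
        ... | v , _ , refl = t∉V (node∈V v)

    2≤flatten : 2 ≤ length (flatten arcs)
    -- One arc is the closing connection, and the path itself has at least one more.
    2≤flatten = ℕ.≤-trans (s≤s (ℕ.≤-trans (s≤s z≤n) (ℕ.≤-reflexive (sym length≡)))) (flatten-length arcs)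

    result : ContainsSecondHamiltonianCycle G V
    result with cycleFromList G (node H zero) (flatten arcs) 2≤flatten route-chain route-once
    ... | d , dG , on = H , d , (inj₁ , onV) , (dG , through) , differ (on u∈route)
      where
      through : ∀ {t} → t ∈ˢ V → t IsOn d
      through {t} t∈V = on (occ⇒∈ Fin._≟_ route (subst (1 ≤_) (sym (occ-route t))
        (ℕ.≤-trans (ℕ.≤-reflexive (sym (visits-V t∈V))) (ℕ.m≤m+n _ (uses t arcs)))))
      u∈route : u ∈ route
      u∈route = occ⇒∈ Fin._≟_ route (subst (1 ≤_) (sym (occ-route u))
                  (ℕ.≤-trans (∈⇒occ _≟ᴸ_ {just u} {map proj₁ arcs} u∈) (ℕ.m≤n+m (uses u arcs) _)))
      u∉V : u ∉ˢ V
      u∉V = used∉V zero arcs allLinks u∈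
      differ : u IsOn d → DifferInAnEdge H d
      -- The edge by which `d` leaves `u` is not an edge of H, because all nodes of H lie in V.
      differ (i , refl) = u , node d (next i) , inj₂ (inj₁ (i , refl , refl) , λ
        { (inj₁ (j , eq , _)) → u∉V (subst (_∈ˢ V) eq (node∈V j))
        ; (inj₂ (j , _ , eq)) → u∉V (subst (_∈ˢ V) eq (node∈V (next j))) })

  second : ContainsSecondHamiltonianCycle G V
  second = extract (another-closing P₀ P₀-closed (refl ∷ P₀-labels) P₀-unique)
    where
    extract : ∃[ P ] ∃[ c ] Closed P c × Σ[ u ∈ Fin n ] just u ∈ (c ∷ map proj₁ (proj₂ P)) →
      ContainsSecondHamiltonianCycle G V
    extract (P , c , C , u , u∈) = Closing.result C u∈

lemma2p12 : ∀ {n : ℕ} (V U : Subset n) (H : Cycle n) (Gb : BipartiteGraph V U) →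
    HasNodeSet H V →
    ∣ V ∣ ≤ 15 →
    Connected (graph Gb) →
    ContainsSecondHamiltonianCycle (cycleGraph H ∪ᴳ graph Gb) V
lemma2p12 V U H Gb onV _ connected = SecondCycle.second H Gb onV connected
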